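{- Let $H$ be a pseudoexpander with $m$ roots. (1) For every pseudoedge $\{t_i,t_j\}$ of $H$, $Pr(X_{i,j}=1)\ge\frac{3}{128}m^{ -4/4.9}$. (2) For every pseudomatching $M$ of $H$, the random variables $\{X_{i,j}:\{t_i,t_j\}\in M\}$ are mutually independent.
   Context: Binary-tree-based graph: $H$ is an edge-disjoint union of extended rooted trees (no leaf has a sibling) $T_1,\dots,T_m$ with roots $t_1,\dots,t_m$, every vertex that is a leaf of some $T_i$ is a leaf of exactly two trees, and any two trees share at most one vertex, which is a leaf of both. Root variables are roots, leaf variables are leaves of the trees, internal variables the remaining vertices (each in exactly one tree); internal vertices are siblings if they lie in the same $T_i$ and are siblings there. If $T_i,T_j$ share a leaf $\ell_{i,j}$, $\{t_i,t_j\}$ is a pseudoedge and $P_{i,j}$ is the path from $t_i$ to $t_j$ in $T_i\cup T_j$. A pseudomatching is a set of pseudoedges with pairwise disjoint ends. $H$ is a pseudoexpander if every tree has height (max number of vertices on a root–leaf path) $\le(\log_2 m)/4.9+3$ and any two disjoint root sets of size $\ge m^{0.999}$ admit a pseudomatching of size $\ge m^{0.999}/3$ with each pseudoedge having one end in each set. $\phi_H$: monotone CNF over $V(H)$ with one clause $C_{i,j}=\bigvee_{v\in V(P_{i,j})}v$ per pseudoedge. Sets of literals never contain a variable with its negation. $Fix(S)$: set of positive literals $\ell_{i,j}\in S$ with all other variables of $C_{i,j}$ negative in $S$. Probability space: sample space ${\bf SAT}(H)$ of sets of literals over all of $V(H)$ satisfying $\phi_H$, $Pr(\{S\})=2^{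 -|S\setminus Fix(S)|}$. $S$ respects $\{t_i,t_j\}$ if all non-root variables of $C_{i,j}$ occur negatively in $S$ and all siblings of internal variables of $C_{i,j}$ occur positively in $S$. $X_{i,j}$ is the 0/1 random variable on ${\bf SAT}(H)$ with $X_{i,j}(S)=1$ iff $S$ respects $\{t_i,t_j\}$. -}

module Defs where

open import Data.Nat as ℕ using (ℕ; zero; suc; _∸_; _≤_)
open import Data.Bool using (Bool; true; false; _∧_; _∨_; not; if_then_else_; T)
open import Data.Fin using (Fin; _≟_)
open import Data.Fin.Subset as Sub using (Subset; _∈_; ∣_∣; Empty; _∩_)
open import Data.List as L using (List; []; _∷_; allFin; any; filter; length; foldr; map; zipWith; concatMap)
open import Data.List.Relation.Unary.All using (All)
open import Data.List.Relation.Unary.Unique.Propositional using (Unique)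
open import Data.Product using (Σ; _×_; _,_; ∃; ∃-syntax)
open import Data.Sum using (_⊎_)
open import Relation.Nullary using (¬_; ⌊_⌋)
open import Relation.Binary.PropositionalEquality using (_≡_; _≢_)
open import Data.Rational as ℚ using (ℚ; ½; 0ℚ; 1ℚ)

-- Raw data of a candidate binary-tree-based graph H.
--   vertices  : Fin n   (the variables V(H))
--   trees     : Fin m   (T_1 … T_m)
--   mem i v   : v ∈ V(T_i)
--   root i    : the root t_i of T_i
--   par i v   : the parent of v in T_i (meaningful for non-root v ∈ V(T_i))

record Raw : Set where
  field
    n    : ℕ
    m    : ℕ
    mem  : Fin m → Fin n → Bool
    root : Fin m → Fin n
    par  : Fin m → Fin n → Fin n

all : ∀ {A : Set} → (A → Bool) → List A → Bool
all p = foldr (λ x b → p x ∧ b) true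

powℚ : ℚ → ℕ → ℚ
powℚ q zero    = 1ℚ
powℚ q (suc k) = q ℚ.* powℚ q k

_≡ᵇ_ : Bool → Bool → Bool
true  ≡ᵇ b = b
false ≡ᵇ b = not b

module _ (H : Raw) where
  open Raw H

  _==_ : Fin n → Fin n → Bool
  u == v = ⌊ u ≟ v ⌋

  step : Fin m → Fin n → Fin n
  step i v = if v == root i then v else par i v

  iter : Fin m → ℕ → Fin n → Fin n
  iter i zero    v = v
  iter i (suc k) v = step i (iter i k v)

  nonroot : Fin m → Fin n → Bool
  nonroot i v = mem i v ∧ not (v == root i)

  child : Fin m → Fin n → Fin n → Bool
  child i u c = nonroot i c ∧ (par i c == u)

  leaf : Fin m → Fin n → Bool
  leaf i v = mem i v ∧ not (any (child i v) (allFin n))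

  sibIn : Fin m → Fin n → Fin n → Bool
  sibIn i u w = nonroot i u ∧ nonroot i w ∧ not (u == w) ∧ (par i u == par i w)

  rootVar : Fin n → Bool
  rootVar v = any (λ i → root i == v) (allFin m)

  leafVar : Fin n → Bool
  leafVar v = any (λ i → leaf i v) (allFin m)

  internalVar : Fin n → Bool
  internalVar v = not (rootVar v) ∧ not (leafVar v)

  siblings : Fin n → Fin n → Bool
  siblings u w = internalVar u ∧ internalVar w ∧ any (λ i → sibIn i u w) (allFin m)

  anc : Fin m → Fin n → Fin n → Bool
  anc i x v = any (λ k → iter i k x == v) (L.upTo (suc n))

  IsPseudoedge : Fin m → Fin m → Fin n → Set
  IsPseudoedge i j ℓ = i ≢ j × T (leaf i ℓ) × T (leaf j ℓ)

  isPseudoedge : Fin m → Fin m → Fin n → Bool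
  isPseudoedge i j ℓ = not ⌊ i ≟ j ⌋ ∧ leaf i ℓ ∧ leaf j ℓ

  -- v ∈ V(P_{i,j}) , the path from t_i to t_j through ℓ in T_i ∪ T_j
  onPath : Fin m → Fin m → Fin n → Fin n → Bool
  onPath i j ℓ v = anc i ℓ v ∨ anc j ℓ v

  vertices : List (Fin n)
  vertices = allFin n

  IsRootedTree : Fin m → Set
  IsRootedTree i =
    T (mem i (root i)) ×
    (∀ v → T (nonroot i v) → T (mem i (par i v))) ×
    (∀ v → T (mem i v) → ∃[ k ] iter i k v ≡ root i)

  IsExtendedBinary : Fin m → Set
  IsExtendedBinary i =
    (∀ u a b c → T (child i u a) → T (child i u b) → T (child i u c) →
       a ≡ b ⊎ a ≡ c ⊎ b ≡ c) ×
    (∀ v w → T (leaf i v) → ¬ T (sibIn i v w))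

  SameEdge : Fin m → Fin n → Fin m → Fin n → Set
  SameEdge i v j w = (v ≡ w × par i v ≡ par j w) ⊎ (v ≡ par j w × par i v ≡ w)

  record IsBTG : Set where
    field
      trees       : ∀ i → IsRootedTree i
      extended    : ∀ i → IsExtendedBinary i
      covers      : ∀ (v : Fin n) → ∃[ i ] T (mem i v)
      edgeDisj    : ∀ i j v w → i ≢ j → T (nonroot i v) → T (nonroot j w) →
                    ¬ SameEdge i v j w
      leafTwo     : ∀ i v → T (leaf i v) →
                    ∃[ j ] (j ≢ i × T (leaf j v) ×
                            (∀ k → T (leaf k v) → k ≡ i ⊎ k ≡ j))
      shareOne    : ∀ i j u v → i ≢ j →
                    T (mem i u) → T (mem j u) → T (mem i v) → T (mem j v) → u ≡ v
      shareLeaf   : ∀ i j v → i ≢ j → T (mem i v) → T (mem j v) →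
                    T (leaf i v) × T (leaf j v)

  PE : Set
  PE = Fin m × Fin m × Fin n

  ends : List PE → List (Fin m)
  ends = concatMap (λ { (i , j , _) → i ∷ j ∷ [] })

  IsPseudomatching : List PE → Set
  IsPseudomatching M = All (λ { (i , j , ℓ) → IsPseudoedge i j ℓ }) M × Unique (ends M)

  -- Pseudoexpander
  --  height(T_i) ≤ log₂ m / 4.9 + 3  ⇔  2^(49·(h ∸ 3)) ≤ m^10, h = #vertices on root–leaf path
  --  |A| ≥ m^0.999                  ⇔  |A|^1000 ≥ m^999
  --  |M| ≥ m^0.999 / 3               ⇔  (3|M|)^1000 ≥ m^999

  HeightOK : Set
  HeightOK = ∀ i ℓ → T (leaf i ℓ) →
    ∃[ k ] (iter i k ℓ ≡ root i × 2 ℕ.^ (49 ℕ.* (suc k ∸ 3)) ≤ m ℕ.^ 10)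

  Expands : Set
  Expands = ∀ (A B : Subset m) → Empty (A ∩ B) →
    m ℕ.^ 999 ≤ ∣ A ∣ ℕ.^ 1000 → m ℕ.^ 999 ≤ ∣ B ∣ ℕ.^ 1000 →
    ∃[ M ] (IsPseudomatching M ×
            All (λ { (i , j , _) → (i ∈ A × j ∈ B) ⊎ (i ∈ B × j ∈ A) }) M ×
            m ℕ.^ 999 ≤ (3 ℕ.* length M) ℕ.^ 1000)

  record IsPseudoexpander : Set where
    field
      btg     : IsBTG
      height  : HeightOK
      expands : Expands

  -- Probability space on SAT(H). A set of literals over all of V(H) is a
  -- total assignment σ (σ v = true ⇔ the literal v ∈ S, false ⇔ ¬v ∈ S).

  Assignment : Set
  Assignment = Fin n → Bool

  clauseSat : Assignment → PE → Bool
  clauseSat σ (i , j , ℓ) = any (λ v → onPath i j ℓ v ∧ σ v) vertices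

  allPE : List PE
  allPE = concatMap (λ i → concatMap (λ j → map (λ ℓ → i , j , ℓ) vertices) (allFin m)) (allFin m)

  pseudoedges : List PE
  pseudoedges = filter (λ { (i , j , ℓ) → T? (isPseudoedge i j ℓ) }) allPE
    where
    open import Relation.Nullary.Decidable using (Dec)
    open import Data.Bool.Properties using (T?)

  satφ : Assignment → Bool
  satφ σ = all (clauseSat σ) pseudoedges

  inFix : Assignment → Fin n → Bool
  inFix σ v = σ v ∧ any (λ { (i , j , ℓ) → (ℓ == v) ∧
                 all (λ w → not (onPath i j ℓ w) ∨ (w == v) ∨ not (σ w)) vertices })
               pseudoedges

  fixSize : Assignment → ℕ
  fixSize σ = length (filter (λ v → T? (inFix σ v)) vertices)
    where open import Data.Bool.Properties using (T?)

  -- Pr({S}) = 2^(-|S \ Fix(S)|), with |S| = n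
  weight : Assignment → ℚ
  weight σ = powℚ ½ (n ∸ fixSize σ)

  assignments : (k : ℕ) → List (Fin k → Bool)
  assignments zero    = (λ ()) ∷ []
  assignments (suc k) = concatMap (λ f → (λ { Fin.zero → false ; (Fin.suc x) → f x })
                                       ∷ (λ { Fin.zero → true ; (Fin.suc x) → f x }) ∷ [])
                                  (assignments k)

  SAT : List Assignment
  SAT = filter (λ σ → T? (satφ σ)) (assignments n)
    where open import Data.Bool.Properties using (T?)

  Pr : (Assignment → Bool) → ℚ
  Pr E = foldr ℚ._+_ 0ℚ (map weight (filter (λ σ → T? (E σ)) SAT))
    where open import Data.Bool.Properties using (T?)

  respects : PE → Assignment → Bool
  respects (i , j , ℓ) σ =
    all (λ v → not (onPath i j ℓ v) ∨ rootVar v ∨ not (σ v)) vertices ∧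
    all (λ v → not (onPath i j ℓ v ∧ internalVar v) ∨
               all (λ w → not (siblings v w) ∨ σ w) vertices) vertices

  X : PE → Assignment → Bool
  X = respects

  jointEvent : List PE → List Bool → Assignment → Bool
  jointEvent M bs σ = all (λ x → x) (zipWith (λ e b → X e σ ≡ᵇ b) M bs)

  MutuallyIndependent : List PE → Set
  MutuallyIndependent M = ∀ (bs : List Bool) → length bs ≡ length M →
    Pr (jointEvent M bs) ≡ foldr ℚ._*_ 1ℚ (zipWith (λ e b → Pr (λ σ → X e σ ≡ᵇ b)) M bs)

module Submission where

{- Sample uniform bits τ and switch on every leaf variable whose clause has all its other variables
   negative; since only nonleaf variables decide which leaves are switched on, the outcome has the law Pr.
   After this change of variables X_{i,j} depends only on the bits of ℓ_{i,j} and of the nonleaf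
   vertices of T_i ∪ T_j, so pseudoedges with disjoint ends use disjoint sets of bits. For (1), a tree of
   height h prescribes at most 2(h - 2) bits (internal path vertices and their siblings); the leaf has to be
   negative and one of the two roots positive, which costs a factor 3/8. -}

open import Defs
open import Data.Nat as ℕ using (ℕ; zero; suc; _∸_)
import Data.Nat.Properties as ℕₚ
open import Data.Nat.Solver renaming (module +-*-Solver to ℕ-Solver)
import Data.Integer as ℤ
open import Data.Integer using (+_)
import Data.Integer.Properties as ℤₚ
open import Data.Rational using (ℚ; _/_; _≤_; _*_; _+_; ½; 0ℚ; 1ℚ; *≤*; nonNegative; toℚᵘ)
open import Data.Rational.Properties as ℚₚ
  using (*-assoc; *-comm; *-zeroˡ; *-zeroʳ; *-identityˡ; *-identityʳ; +-identityˡ; +-identityʳ;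
         ≤-refl; ≤-trans; ≤-reflexive)
open import Data.Rational.Solver using (module +-*-Solver)
open import Data.Rational.Unnormalised as ℚᵘ using (mkℚᵘ)
import Data.Rational.Unnormalised.Properties as ℚᵘₚ
open import Data.Bool using (Bool; true; false; _∧_; _∨_; not; if_then_else_; T)
open import Data.Bool.ListAction using (any)
open import Data.Bool.Properties using (T?; T-≡; T-∧; T-∨; ∨-identityʳ; ∨-comm)
open import Data.Fin as Fin using (Fin; zero; suc; _≟_; toℕ)
import Data.Fin.Properties as Finₚ
open import Data.Product using (_×_; _,_; proj₁; proj₂; ∃-syntax)
open import Data.Sum as Sum using (_⊎_; inj₁; inj₂; [_,_]′)
open import Data.Empty using (⊥; ⊥-elim)
open import Data.List using (List; []; _∷_; map; filter; foldr; length; tabulate; concatMap; _++_; allFin; upTo; zipWith)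
open import Data.List.Properties using (length-filter; length-tabulate; length-++; map-tabulate)
open import Data.List.Membership.Propositional using (_∈_; lose; find)
open import Data.List.Membership.Propositional.Properties using (∈-allFin; ∈-upTo⁺; ∈-++⁺ˡ; ∈-++⁺ʳ)
open import Data.List.Relation.Unary.All as All using (All; []; _∷_)
import Data.List.Relation.Unary.All.Properties as Allₚ
open import Data.List.Relation.Unary.AllPairs using (_∷_)
open import Data.List.Relation.Unary.Any using (Any; here; there; satisfied)
open import Data.List.Relation.Unary.Any.Properties using (any⁺; any⁻)
open import Function using (_∘_; id; Equivalence)
open import Relation.Nullary using (¬_; ⌊_⌋; yes; no)
open import Relation.Nullary.Decidable using (toWitness; fromWitness)
open import Relation.Binary.PropositionalEquality

-- Expectation over independent fair bits

-- The obstacle is that `Fix` couples the weight of an assignment to all variables of a clause, so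
-- Pr is not a product measure. Relative to fair bits, an unsatisfying assignment has density 0 and
-- every fixed leaf contributes a factor 2. These effects balance: the mass at which the leaf would
-- violate its clause is moved to the same assignment with a positive leaf. The moves do not
-- interfere, because a leaf lies in exactly two trees, hence in one clause, and no other leaf
-- occurs in that clause. The constant in (1): with h at most (log m)/4.9 + 3, the two trees
-- together prescribe at most 4(log m)/4.9 + 4 bits, and the surplus 4 gives (3/8)/16 = 3/128. The
-- fractional exponent is avoided by comparing 49th powers, where m enters with exponent 40.

Bits : ℕ → Set
Bits k = Fin k → Bool

2ℚ : ℚ
2ℚ = + 2 / 1

𝟙 : Bool → ℚ
𝟙 b = if b then 1ℚ else 0ℚ

cons : ∀ {k} → Bool → Bits k → Bits (suc k)
cons b σ zero    = b
cons b σ (suc v) = σ v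

𝔼 : ∀ {k} → (Bits k → ℚ) → ℚ
𝔼 {zero}  F = F (λ ())
𝔼 {suc k} F = ½ * (𝔼 (F ∘ cons false) + 𝔼 (F ∘ cons true))

-- Assignments are functions, and the same one arises through `cons`, `mix`, `set` and the
-- enumeration `assignments`; these forms are compared only pointwise. A functional whose argument
-- gets rewritten must therefore respect pointwise equality.
Ext : ∀ {k} {A : Set} → (Bits k → A) → Set
Ext F = ∀ {σ τ} → σ ≗ τ → F σ ≡ F τ

cons-cong : ∀ {k b} {σ τ : Bits k} → σ ≗ τ → cons b σ ≗ cons b τ
cons-cong e zero    = refl
cons-cong e (suc v) = e v

Ext-cons : ∀ {k} {A : Set} {F : Bits (suc k) → A} b → Ext F → Ext (F ∘ cons b)
Ext-cons b ext e = ext (cons-cong e)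

𝔼-cong : ∀ {k} {F G : Bits k → ℚ} → F ≗ G → 𝔼 F ≡ 𝔼 G
𝔼-cong {zero}  e = e _
𝔼-cong {suc k} e = cong (½ *_) (cong₂ _+_ (𝔼-cong (e ∘ cons false)) (𝔼-cong (e ∘ cons true)))

𝔼-mono : ∀ {k} {F G : Bits k → ℚ} → (∀ σ → F σ ≤ G σ) → 𝔼 F ≤ 𝔼 G
𝔼-mono {zero}  e = e _
𝔼-mono {suc k} e = ℚₚ.*-monoˡ-≤-nonNeg ½ (ℚₚ.+-mono-≤ (𝔼-mono (e ∘ cons false)) (𝔼-mono (e ∘ cons true)))

𝔼-const : ∀ {k} c → 𝔼 {k} (λ _ → c) ≡ c
𝔼-const {zero}  c = refl
𝔼-const {suc k} c = trans (cong₂ (λ x y → ½ * (x + y)) (𝔼-const {k} c) (𝔼-const {k} c))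
  (solve 1 (λ x → con ½ :* (x :+ x) := x) refl c)
  where open +-*-Solver

𝔼-+ : ∀ {k} (F G : Bits k → ℚ) → 𝔼 (λ σ → F σ + G σ) ≡ 𝔼 F + 𝔼 G
𝔼-+ {zero}  F G = refl
𝔼-+ {suc k} F G = trans
  (cong₂ (λ x y → ½ * (x + y)) (𝔼-+ (F ∘ cons false) (G ∘ cons false)) (𝔼-+ (F ∘ cons true) (G ∘ cons true)))
  (solve 4 (λ a b c d → con ½ :* ((a :+ b) :+ (c :+ d)) := con ½ :* (a :+ c) :+ con ½ :* (b :+ d)) refl
    (𝔼 (F ∘ cons false)) (𝔼 (G ∘ cons false)) (𝔼 (F ∘ cons true)) (𝔼 (G ∘ cons true)))
  where open +-*-Solver

𝔼-*ˡ : ∀ {k} c (F : Bits k → ℚ) → 𝔼 (λ σ → c * F σ) ≡ c * 𝔼 F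
𝔼-*ˡ {zero}  c F = refl
𝔼-*ˡ {suc k} c F = trans
  (cong₂ (λ x y → ½ * (x + y)) (𝔼-*ˡ c (F ∘ cons false)) (𝔼-*ˡ c (F ∘ cons true)))
  (solve 3 (λ c x y → con ½ :* (c :* x :+ c :* y) := c :* (con ½ :* (x :+ y))) refl
    c (𝔼 (F ∘ cons false)) (𝔼 (F ∘ cons true)))
  where open +-*-Solver

𝔼-*ʳ : ∀ {k} c (F : Bits k → ℚ) → 𝔼 (λ σ → F σ * c) ≡ 𝔼 F * c
𝔼-*ʳ c F = trans (𝔼-cong (λ σ → *-comm (F σ) c)) (trans (𝔼-*ˡ c F) (*-comm c (𝔼 F)))

𝔼-avg : ∀ {k} (F G : Bits k → ℚ) → 𝔼 (λ σ → ½ * (F σ + G σ)) ≡ ½ * (𝔼 F + 𝔼 G)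
𝔼-avg F G = trans (𝔼-*ˡ ½ (λ σ → F σ + G σ)) (cong (½ *_) (𝔼-+ F G))

½-idem : ∀ x → ½ * (x + x) ≡ x
½-idem = solve 1 (λ x → con ½ :* (x :+ x) := x) refl
  where open +-*-Solver

mix : ∀ {k} → Bits k → Bits k → Bits k → Bits k
mix L ρ σ v = if L v then σ v else ρ v

mix-cons : ∀ {k} (L : Bits (suc k)) b c (ρ σ : Bits k) →
  mix L (cons b ρ) (cons c σ) ≗ cons (if L zero then c else b) (mix (L ∘ suc) ρ σ)
mix-cons L b c ρ σ zero    = refl
mix-cons L b c ρ σ (suc v) = refl

-- Resampling the coordinates of L from an independent copy preserves the uniform measure.
𝔼-mix : ∀ {k} (L : Bits k) (F : Bits k → ℚ) → Ext F →
  𝔼 F ≡ 𝔼 (λ ρ → 𝔼 (λ σ → F (mix L ρ σ)))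
𝔼-mix {zero}  L F ext = ext (λ ())
𝔼-mix {suc k} L F ext = sym (trans (cong₂ (λ x y → ½ * (x + y)) (row false) (row true)) (collect (L zero)))
  where
  open ≡-Reasoning
  pick : Bool → Bool → Bool
  pick b c = if L zero then c else b
  half : Bool → ℚ
  half b = 𝔼 (F ∘ cons b)
  entry : ∀ b c → 𝔼 (λ ρ → 𝔼 (λ σ → F (mix L (cons b ρ) (cons c σ)))) ≡ half (pick b c)
  entry b c = trans
    (𝔼-cong (λ ρ → 𝔼-cong (λ σ → ext (mix-cons L b c ρ σ))))
    (sym (𝔼-mix (L ∘ suc) (F ∘ cons (pick b c)) (Ext-cons (pick b c) ext)))
  row : ∀ b → 𝔼 (λ ρ → 𝔼 (λ σ → F (mix L (cons b ρ) σ))) ≡ ½ * (half (pick b false) + half (pick b true))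
  row b = trans
    (𝔼-avg (λ ρ → 𝔼 (λ σ → F (mix L (cons b ρ) (cons false σ)))) (λ ρ → 𝔼 (λ σ → F (mix L (cons b ρ) (cons true σ)))))
    (cong₂ (λ x y → ½ * (x + y)) (entry b false) (entry b true))
  collect : ∀ l →
    ½ * (½ * (half (if l then false else false) + half (if l then true else false))
       + ½ * (half (if l then false else true) + half (if l then true else true)))
    ≡ ½ * (half false + half true)
  collect true  = ½-idem _
  collect false = cong₂ (λ x y → ½ * (x + y)) (½-idem (half false)) (½-idem (half true))

DependsOn : ∀ {k} {A : Set} → (Fin k → Set) → (Bits k → A) → Set
DependsOn S F = ∀ {σ τ} → (∀ v → S v → σ v ≡ τ v) → F σ ≡ F τ

-- By `𝔼-mix` the coordinates of `L` may come from a separate sample. Then `F` sees only the first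
-- sample and `G` only the second, and the iterated expectation splits.
𝔼-indep : ∀ {k} (L : Bits k) {F G : Bits k → ℚ} →
  DependsOn (λ v → L v ≡ false) F → DependsOn (λ v → L v ≡ true) G →
  𝔼 (λ σ → F σ * G σ) ≡ 𝔼 F * 𝔼 G
𝔼-indep L {F} {G} dF dG = begin
  𝔼 (λ σ → F σ * G σ)
    ≡⟨ 𝔼-mix L _ (λ e → cong₂ _*_ (dF (λ v _ → e v)) (dG (λ v _ → e v))) ⟩
  𝔼 (λ ρ → 𝔼 (λ σ → F (mix L ρ σ) * G (mix L ρ σ)))
    ≡⟨ 𝔼-cong (λ ρ → 𝔼-cong (λ σ → cong₂ _*_
         (dF (λ v e → cong (λ b → if b then σ v else ρ v) e))
         (dG (λ v e → cong (λ b → if b then σ v else ρ v) e)))) ⟩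
  𝔼 (λ ρ → 𝔼 (λ σ → F ρ * G σ))
    ≡⟨ 𝔼-cong (λ ρ → 𝔼-*ˡ (F ρ) G) ⟩
  𝔼 (λ ρ → F ρ * 𝔼 G)
    ≡⟨ 𝔼-*ʳ (𝔼 G) F ⟩
  𝔼 F * 𝔼 G ∎
  where open ≡-Reasoning

∏ : ∀ {k} → (Fin k → ℚ) → ℚ
∏ g = foldr _*_ 1ℚ (tabulate g)

∏-cong : ∀ {k} {f g : Fin k → ℚ} → f ≗ g → ∏ f ≡ ∏ g
∏-cong {zero}  e = refl
∏-cong {suc k} e = cong₂ _*_ (e zero) (∏-cong (e ∘ suc))

∏-zero : ∀ {k} {g : Fin k → ℚ} v → g v ≡ 0ℚ → ∏ g ≡ 0ℚ
∏-zero {g = g} zero    e = trans (cong (_* ∏ (g ∘ suc)) e) (*-zeroˡ (∏ (g ∘ suc)))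
∏-zero {g = g} (suc v) e = trans (cong (g zero *_) (∏-zero v e)) (*-zeroʳ (g zero))

-- The density, relative to a fair bit, of a bit that is set to true when c holds.
tilt : Bool → Bool → ℚ
tilt c b = if c then (if b then 2ℚ else 0ℚ) else 1ℚ

-- Where `c` holds, the factors 0 and 2 move the mass of both values onto true, exactly as
-- `τ v ∨ c v` does. The pattern `c` must be constant in the sample; `Pr-force` achieves this by
-- resampling.
𝔼-tilt : ∀ {k} (c : Bits k) (F : Bits k → ℚ) → Ext F →
  𝔼 (λ σ → F σ * ∏ (λ v → tilt (c v) (σ v))) ≡ 𝔼 (λ τ → F (λ v → τ v ∨ c v))
𝔼-tilt {zero}  c F ext = trans (*-identityʳ _) (ext (λ ()))
𝔼-tilt {suc k} c F ext = begin
  ½ * (𝔼 (λ σ → F (cons false σ) * (tilt (c zero) false * P σ))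
     + 𝔼 (λ σ → F (cons true σ) * (tilt (c zero) true * P σ)))
    ≡⟨ cong₂ (λ x y → ½ * (x + y)) (pull false) (pull true) ⟩
  ½ * (tilt (c zero) false * half false + tilt (c zero) true * half true)
    ≡⟨ collect (c zero) ⟩
  ½ * (half (false ∨ c zero) + half (true ∨ c zero))
    ≡⟨ cong₂ (λ x y → ½ * (x + y)) (push false) (push true) ⟩
  𝔼 (λ τ → F (λ v → τ v ∨ c v)) ∎
  where
  open ≡-Reasoning
  P : Bits k → ℚ
  P σ = ∏ (λ v → tilt (c (suc v)) (σ v))
  half : Bool → ℚ
  half b = 𝔼 (λ τ → F (cons b (λ v → τ v ∨ c (suc v))))
  pull : ∀ b → 𝔼 (λ σ → F (cons b σ) * (tilt (c zero) b * P σ)) ≡ tilt (c zero) b * half b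
  pull b = begin
    𝔼 (λ σ → F (cons b σ) * (tilt (c zero) b * P σ))
      ≡⟨ 𝔼-cong (λ σ → solve 3 (λ x t p → x :* (t :* p) := t :* (x :* p)) refl
           (F (cons b σ)) (tilt (c zero) b) (P σ)) ⟩
    𝔼 (λ σ → tilt (c zero) b * (F (cons b σ) * P σ))
      ≡⟨ 𝔼-*ˡ (tilt (c zero) b) (λ σ → F (cons b σ) * P σ) ⟩
    tilt (c zero) b * 𝔼 (λ σ → F (cons b σ) * P σ)
      ≡⟨ cong (tilt (c zero) b *_) (𝔼-tilt (c ∘ suc) (F ∘ cons b) (Ext-cons b ext)) ⟩
    tilt (c zero) b * half b ∎
    where open +-*-Solver
  collect : ∀ d → ½ * (tilt d false * half false + tilt d true * half true)
    ≡ ½ * (half (false ∨ d) + half (true ∨ d))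
  collect true  = solve 2 (λ x y → con ½ :* (con 0ℚ :* x :+ con 2ℚ :* y) := con ½ :* (y :+ y)) refl
    (half false) (half true)
    where open +-*-Solver
  collect false = cong₂ (λ x y → ½ * (x + y)) (*-identityˡ (half false)) (*-identityˡ (half true))
  push : ∀ b → half (b ∨ c zero) ≡ 𝔼 (λ τ → F (λ v → cons b τ v ∨ c v))
  push b = 𝔼-cong (λ τ → ext (pointwise τ))
    where
    pointwise : ∀ τ → cons (b ∨ c zero) (λ v → τ v ∨ c (suc v)) ≗ (λ v → cons b τ v ∨ c v)
    pointwise τ zero    = refl
    pointwise τ (suc v) = refl

set : ∀ {k} → Bits k → Fin k → Bool → Bits k
set σ v b w with w ≟ v
... | yes _ = b
... | no  _ = σ w

set-same : ∀ {k} (σ : Bits k) v b → set σ v b v ≡ b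
set-same σ v b with v ≟ v
... | yes _ = refl
... | no  n = ⊥-elim (n refl)

-- Splits at an arbitrary coordinate without changing the number of bits: the overwritten coordinate
-- is still sampled, but without effect.
𝔼-set : ∀ {k} (F : Bits k → ℚ) → Ext F → ∀ v →
  𝔼 F ≡ ½ * (𝔼 (λ σ → F (set σ v false)) + 𝔼 (λ σ → F (set σ v true)))
𝔼-set F ext zero = cong₂ (λ x y → ½ * (x + y)) (half false) (half true)
  where
  half : ∀ b → 𝔼 (F ∘ cons b) ≡ 𝔼 (λ σ → F (set σ zero b))
  half b = sym (trans (cong₂ (λ x y → ½ * (x + y)) (eq false) (eq true)) (½-idem (𝔼 (F ∘ cons b))))
    where
    eq : ∀ c → 𝔼 (λ σ → F (set (cons c σ) zero b)) ≡ 𝔼 (F ∘ cons b)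
    eq c = 𝔼-cong (λ σ → ext (pointwise σ))
      where
      pointwise : ∀ σ → set (cons c σ) zero b ≗ cons b σ
      pointwise σ zero    = refl
      pointwise σ (suc v) = refl
𝔼-set F ext (suc v) = trans
  (cong₂ (λ x y → ½ * (x + y))
    (𝔼-set (F ∘ cons false) (Ext-cons false ext) v) (𝔼-set (F ∘ cons true) (Ext-cons true ext) v))
  (trans (solve 4 (λ a b c d → con ½ :* (con ½ :* (a :+ b) :+ con ½ :* (c :+ d))
                        := con ½ :* (con ½ :* (a :+ c) :+ con ½ :* (b :+ d))) refl
            (E false false) (E false true) (E true false) (E true true))
         (cong₂ (λ x y → ½ * (x + y)) (half false) (half true)))
  where
  open +-*-Solver
  E : Bool → Bool → ℚ
  E c b = 𝔼 (λ σ → F (cons c (set σ v b)))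
  shift : ∀ b c (σ : Bits _) → cons c (set σ v b) ≗ set (cons c σ) (suc v) b
  shift b c σ zero = refl
  shift b c σ (suc w) with w ≟ v
  ... | yes _ = refl
  ... | no  _ = refl
  half : ∀ b →
    ½ * (𝔼 (λ σ → F (cons false (set σ v b))) + 𝔼 (λ σ → F (cons true (set σ v b))))
    ≡ 𝔼 (λ σ → F (set σ (suc v) b))
  half b = cong₂ (λ x y → ½ * (x + y)) (𝔼-cong (λ σ → ext (shift b false σ))) (𝔼-cong (λ σ → ext (shift b true σ)))

-- Probability of prescribing the values of listed bits

≡ᵇ-true : ∀ {a b} → T (a ≡ᵇ b) → a ≡ b
≡ᵇ-true {true}  {true}  _ = refl
≡ᵇ-true {false} {false} _ = refl

≡ᵇ-refl : ∀ a → (a ≡ᵇ a) ≡ true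
≡ᵇ-refl true  = refl
≡ᵇ-refl false = refl

matches : ∀ {k} → Bits k → List (Fin k) → Bits k → Bool
matches b vs σ = all (λ v → σ v ≡ᵇ b v) vs

matches-ext : ∀ {k} (b : Bits k) vs → Ext (matches b vs)
matches-ext b []       e = refl
matches-ext b (v ∷ vs) e = cong₂ _∧_ (cong (_≡ᵇ b v) (e v)) (matches-ext b vs e)

𝟙-mono : ∀ {a b} → (T a → T b) → 𝟙 a ≤ 𝟙 b
𝟙-mono {true}  {true}  f = ≤-refl
𝟙-mono {true}  {false} f = ⊥-elim (f _)
𝟙-mono {false} {true}  f = ℚₚ.nonNegative⁻¹ 1ℚ
𝟙-mono {false} {false} f = ≤-refl

set-matches : ∀ {k} (b : Bits k) v σ w → T (σ w ≡ᵇ b w) → T (set σ v (b v) w ≡ᵇ b w)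
set-matches b v σ w t with w ≟ v
... | yes refl = subst T (sym (≡ᵇ-refl (b w))) _
... | no  _    = t

-- All demands are read from the single function `b`, so overwriting `v` by `b v` cannot spoil one,
-- even if `v` occurs in `vs`.
matches-set : ∀ {k} (b : Bits k) vs v σ → T (matches b vs σ) → T (matches b vs (set σ v (b v)))
matches-set b []       v σ t = _
matches-set b (w ∷ vs) v σ t with Equivalence.to T-∧ t
... | t₁ , t₂ = Equivalence.from T-∧ (set-matches b v σ w t₁ , matches-set b vs v σ t₂)

𝟙-nonNeg : ∀ b → 0ℚ ≤ 𝟙 b
𝟙-nonNeg b = 𝟙-mono {false} {b} ⊥-elim

𝔼𝟙-nonNeg : ∀ {k} (A : Bits k → Bool) → 0ℚ ≤ 𝔼 (λ σ → 𝟙 (A σ))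
𝔼𝟙-nonNeg {k} A = ≤-trans (≤-reflexive (sym (𝔼-const {k} 0ℚ))) (𝔼-mono (λ σ → 𝟙-nonNeg (A σ)))

half≤avg : ∀ b (x : Bool → ℚ) → (∀ c → 0ℚ ≤ x c) → ½ * x b ≤ ½ * (x false + x true)
half≤avg false x p = ℚₚ.*-monoˡ-≤-nonNeg ½
  (≤-trans (≤-reflexive (sym (+-identityʳ (x false)))) (ℚₚ.+-monoʳ-≤ (x false) (p true)))
half≤avg true x p = ℚₚ.*-monoˡ-≤-nonNeg ½
  (≤-trans (≤-reflexive (sym (+-identityˡ (x true)))) (ℚₚ.+-monoˡ-≤ (x true) (p false)))

-- Repetitions in vs are harmless: they only weaken the bound.
𝔼-matches : ∀ {k} (b : Bits k) vs → powℚ ½ (length vs) ≤ 𝔼 (λ σ → 𝟙 (matches b vs σ))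
𝔼-matches {k} b [] = ≤-reflexive (sym (𝔼-const {k} 1ℚ))
𝔼-matches b (v ∷ vs) = begin
  ½ * powℚ ½ (length vs)
    ≤⟨ ℚₚ.*-monoˡ-≤-nonNeg ½ (𝔼-matches b vs) ⟩
  ½ * 𝔼 (λ σ → 𝟙 (matches b vs σ))
    ≤⟨ ℚₚ.*-monoˡ-≤-nonNeg ½ (𝔼-mono (λ σ → 𝟙-mono (λ t → Equivalence.from T-∧
         (subst T (sym (trans (cong (_≡ᵇ b v) (set-same σ v (b v))) (≡ᵇ-refl (b v)))) _ ,
          matches-set b vs v σ t)))) ⟩
  ½ * 𝔼 (λ σ → 𝟙 (matches b (v ∷ vs) (set σ v (b v))))
    ≤⟨ half≤avg (b v) (λ c → 𝔼 (λ σ → 𝟙 (matches b (v ∷ vs) (set σ v c))))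
         (λ c → 𝔼𝟙-nonNeg (λ σ → matches b (v ∷ vs) (set σ v c))) ⟩
  ½ * (𝔼 (λ σ → 𝟙 (matches b (v ∷ vs) (set σ v false))) + 𝔼 (λ σ → 𝟙 (matches b (v ∷ vs) (set σ v true))))
    ≡⟨ 𝔼-set (λ σ → 𝟙 (matches b (v ∷ vs) σ)) (cong 𝟙 ∘ matches-ext b (v ∷ vs)) v ⟨
  𝔼 (λ σ → 𝟙 (matches b (v ∷ vs) σ)) ∎
  where open ℚₚ.≤-Reasoning

-- Sums over the enumerated assignments

sumL : ∀ {A : Set} → (A → ℚ) → List A → ℚ
sumL f xs = foldr _+_ 0ℚ (map f xs)

sumL-filter : ∀ {A : Set} (p : A → Bool) (f : A → ℚ) xs →
  sumL f (filter (λ x → T? (p x)) xs) ≡ sumL (λ x → 𝟙 (p x) * f x) xs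
sumL-filter p f []       = refl
sumL-filter p f (x ∷ xs) with p x
... | true  = cong₂ _+_ (sym (*-identityˡ (f x))) (sumL-filter p f xs)
... | false = trans (sumL-filter p f xs)
  (sym (trans (cong (_+ _) (*-zeroˡ (f x))) (+-identityˡ (sumL (λ x → 𝟙 (p x) * f x) xs))))

sumL-cong : ∀ {A : Set} {f g : A → ℚ} → f ≗ g → sumL f ≗ sumL g
sumL-cong e []       = refl
sumL-cong e (x ∷ xs) = cong₂ _+_ (e x) (sumL-cong e xs)

sumL-++ : ∀ {A : Set} (f : A → ℚ) xs ys → sumL f (xs ++ ys) ≡ sumL f xs + sumL f ys
sumL-++ f []       ys = sym (+-identityˡ (sumL f ys))
sumL-++ f (x ∷ xs) ys = trans (cong (λ y → f x + y) (sumL-++ f xs ys)) (sym (ℚₚ.+-assoc (f x) (sumL f xs) (sumL f ys)))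

sumL-concatMap : ∀ {A B : Set} (f : B → ℚ) (g : A → List B) xs →
  sumL f (concatMap g xs) ≡ sumL (λ x → sumL f (g x)) xs
sumL-concatMap f g []       = refl
sumL-concatMap f g (x ∷ xs) = trans (sumL-++ f (g x) (concatMap g xs)) (cong (λ y → sumL f (g x) + y) (sumL-concatMap f g xs))

-- Turns the exponent of `weight` into a product with one factor per variable, the shape that
-- `𝔼-tilt` handles.
½^-∸ : ∀ {A : Set} (q : A → Bool) xs →
  powℚ ½ (length xs ∸ length (filter (λ x → T? (q x)) xs))
    ≡ powℚ ½ (length xs) * foldr _*_ 1ℚ (map (λ x → if q x then 2ℚ else 1ℚ) xs)
½^-∸ q [] = refl
½^-∸ q (x ∷ xs) with q x
... | true  = trans (½^-∸ q xs)
  (solve 2 (λ a p → a :* p := (con ½ :* a) :* (con 2ℚ :* p)) refl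
    (powℚ ½ (length xs)) (foldr _*_ 1ℚ (map (λ x → if q x then 2ℚ else 1ℚ) xs)))
  where open +-*-Solver
... | false = trans
  -- The truncated subtraction is exact here because filtering does not lengthen a list.
  (cong (powℚ ½) (ℕₚ.+-∸-assoc 1 (length-filter (λ x → T? (q x)) xs)))
  (trans (cong (½ *_) (½^-∸ q xs))
    (solve 2 (λ a p → con ½ :* (a :* p) := (con ½ :* a) :* (con 1ℚ :* p)) refl
      (powℚ ½ (length xs)) (foldr _*_ 1ℚ (map (λ x → if q x then 2ℚ else 1ℚ) xs))))
  where open +-*-Solver

module _ (H : Raw) where

  -- The enumeration and `𝔼` branch on the same coordinate, so the two extensions of each shorter
  -- assignment are averaged into one term and the induction applies to these averages.
  sumL-assignments : ∀ k (F : Bits k → ℚ) → Ext F →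
    sumL (λ σ → powℚ ½ k * F σ) (assignments H k) ≡ 𝔼 F
  sumL-assignments zero F ext = trans (+-identityʳ (1ℚ * F _)) (trans (*-identityˡ (F _)) (ext (λ ())))
  sumL-assignments (suc k) F ext = begin
    sumL (λ σ → powℚ ½ (suc k) * F σ) (assignments H (suc k))
      ≡⟨ sumL-concatMap (λ σ → powℚ ½ (suc k) * F σ) _ (assignments H k) ⟩
    sumL _ (assignments H k)
      ≡⟨ sumL-cong (λ σ → pair _ _ σ (λ { zero → refl ; (suc v) → refl }) (λ { zero → refl ; (suc v) → refl }))
           (assignments H k) ⟩
    sumL (λ σ → powℚ ½ k * G σ) (assignments H k)
      ≡⟨ sumL-assignments k G G-ext ⟩
    𝔼 G
      ≡⟨ 𝔼-avg (F ∘ cons false) (F ∘ cons true) ⟩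
    𝔼 F ∎
    where
    open ≡-Reasoning
    G : Bits k → ℚ
    G σ = ½ * (F (cons false σ) + F (cons true σ))
    G-ext : Ext G
    G-ext e = cong₂ (λ x y → ½ * (x + y)) (ext (cons-cong e)) (ext (cons-cong e))
    pair : ∀ τ₀ τ₁ σ → τ₀ ≗ cons false σ → τ₁ ≗ cons true σ →
      sumL (λ τ → powℚ ½ (suc k) * F τ) (τ₀ ∷ τ₁ ∷ []) ≡ powℚ ½ k * G σ
    pair τ₀ τ₁ σ e₀ e₁ = trans
      (cong₂ (λ x y → powℚ ½ (suc k) * x + (powℚ ½ (suc k) * y + 0ℚ)) (ext e₀) (ext e₁))
      (solve 3 (λ p x y → (con ½ :* p) :* x :+ ((con ½ :* p) :* y :+ con 0ℚ) := p :* (con ½ :* (x :+ y))) refl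
        (powℚ ½ k) (F (cons false σ)) (F (cons true σ)))
      where open +-*-Solver

-- Powers of rationals

*-mono-≤ : ∀ {p q r s} → 0ℚ ≤ p → 0ℚ ≤ s → p ≤ q → r ≤ s → p * r ≤ q * s
*-mono-≤ {p} {q} {r} {s} 0≤p 0≤s p≤q r≤s = ≤-trans
  (ℚₚ.*-monoˡ-≤-nonNeg p {{nonNegative 0≤p}} r≤s)
  (ℚₚ.*-monoʳ-≤-nonNeg s {{nonNegative 0≤s}} p≤q)

*-nonNeg : ∀ {p q} → 0ℚ ≤ p → 0ℚ ≤ q → 0ℚ ≤ p * q
*-nonNeg {p} {q} 0≤p 0≤q = ≤-trans (≤-reflexive (sym (*-zeroʳ p))) (ℚₚ.*-monoˡ-≤-nonNeg p {{nonNegative 0≤p}} 0≤q)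

powℚ-nonNeg : ∀ {p} k → 0ℚ ≤ p → 0ℚ ≤ powℚ p k
powℚ-nonNeg zero    0≤p = ℚₚ.nonNegative⁻¹ 1ℚ
powℚ-nonNeg (suc k) 0≤p = *-nonNeg 0≤p (powℚ-nonNeg k 0≤p)

powℚ-mono : ∀ {p q} k → 0ℚ ≤ p → p ≤ q → powℚ p k ≤ powℚ q k
powℚ-mono zero    0≤p p≤q = ≤-refl
powℚ-mono (suc k) 0≤p p≤q = *-mono-≤ 0≤p (powℚ-nonNeg k (≤-trans 0≤p p≤q)) p≤q (powℚ-mono k 0≤p p≤q)

powℚ-* : ∀ p q k → powℚ (p * q) k ≡ powℚ p k * powℚ q k
powℚ-* p q zero    = refl
powℚ-* p q (suc k) = trans (cong (p * q *_) (powℚ-* p q k))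
  (solve 4 (λ a b c d → (a :* b) :* (c :* d) := (a :* c) :* (b :* d)) refl p q (powℚ p k) (powℚ q k))
  where open +-*-Solver

powℚ-+ : ∀ p a b → powℚ p (a ℕ.+ b) ≡ powℚ p a * powℚ p b
powℚ-+ p zero    b = sym (*-identityˡ (powℚ p b))
powℚ-+ p (suc a) b = trans (cong (p *_) (powℚ-+ p a b)) (sym (*-assoc p (powℚ p a) (powℚ p b)))

powℚ-powℚ : ∀ p a k → powℚ (powℚ p a) k ≡ powℚ p (k ℕ.* a)
powℚ-powℚ p a zero    = refl
powℚ-powℚ p a (suc k) = trans (cong (powℚ p a *_) (powℚ-powℚ p a k)) (sym (powℚ-+ p a (k ℕ.* a)))

0≤½ : 0ℚ ≤ ½
0≤½ = ℚₚ.nonNegative⁻¹ ½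

powℚ-½-antitone : ∀ {a b} → a ℕ.≤ b → powℚ ½ b ≤ powℚ ½ a
powℚ-½-antitone {b = zero}  ℕ.z≤n = ≤-refl
powℚ-½-antitone {b = suc b} ℕ.z≤n =
  *-mono-≤ 0≤½ (ℚₚ.nonNegative⁻¹ 1ℚ) ½≤1 (powℚ-½-antitone {b = b} ℕ.z≤n)
  where
  ½≤1 : ½ ≤ 1ℚ
  ½≤1 = *≤* (ℤ.+≤+ (ℕ.s≤s ℕ.z≤n))
powℚ-½-antitone (ℕ.s≤s a≤b) = ℚₚ.*-monoˡ-≤-nonNeg ½ (powℚ-½-antitone a≤b)

ι : ℕ → ℚ
ι m = + m / 1

ι-toℚᵘ : ∀ m → toℚᵘ (ι m) ℚᵘ.≃ mkℚᵘ (+ m) 0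
ι-toℚᵘ m = ℚₚ.toℚᵘ-fromℚᵘ (mkℚᵘ (+ m) 0)

ι-mono : ∀ {a b} → a ℕ.≤ b → ι a ≤ ι b
ι-mono {a} {b} a≤b = ℚₚ.toℚᵘ-cancel-≤
  (ℚᵘₚ.≤-respˡ-≃ (ℚᵘₚ.≃-sym (ι-toℚᵘ a)) (ℚᵘₚ.≤-respʳ-≃ (ℚᵘₚ.≃-sym (ι-toℚᵘ b))
    (ℚᵘ.*≤* (ℤₚ.*-monoʳ-≤-nonNeg (+ 1) (ℤ.+≤+ a≤b)))))

ι-* : ∀ a b → ι (a ℕ.* b) ≡ ι a * ι b
ι-* a b = ℚₚ.toℚᵘ-injective (begin
  toℚᵘ (ι (a ℕ.* b))             ≈⟨ ι-toℚᵘ (a ℕ.* b) ⟩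
  mkℚᵘ (+ (a ℕ.* b)) 0           ≈⟨ ℚᵘ.*≡* (cong (ℤ._* + 1) (ℤₚ.pos-* a b)) ⟩
  mkℚᵘ (+ a) 0 ℚᵘ.* mkℚᵘ (+ b) 0 ≈⟨ ℚᵘₚ.*-cong (ι-toℚᵘ a) (ι-toℚᵘ b) ⟨
  toℚᵘ (ι a) ℚᵘ.* toℚᵘ (ι b)     ≈⟨ ℚₚ.toℚᵘ-homo-* (ι a) (ι b) ⟨
  toℚᵘ (ι a * ι b)               ∎)
  where open import Relation.Binary.Reasoning.Setoid ℚᵘₚ.≃-setoid

ι-^ : ∀ m k → ι (m ℕ.^ k) ≡ powℚ (ι m) k
ι-^ m zero    = refl
ι-^ m (suc k) = trans (ι-* m (m ℕ.^ k)) (cong (ι m *_) (ι-^ m k))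

powℚ-1 : ∀ k → powℚ 1ℚ k ≡ 1ℚ
powℚ-1 zero    = refl
powℚ-1 (suc k) = trans (*-identityˡ (powℚ 1ℚ k)) (powℚ-1 k)

1≤½^*ι : ∀ N M → 2 ℕ.^ N ℕ.≤ M → 1ℚ ≤ powℚ ½ N * ι M
1≤½^*ι N M le = ≤-trans (≤-reflexive eq) (ℚₚ.*-monoˡ-≤-nonNeg (powℚ ½ N) {{nonNegative (powℚ-nonNeg N 0≤½)}} (ι-mono le))
  where
  eq : 1ℚ ≡ powℚ ½ N * ι (2 ℕ.^ N)
  eq = begin
    1ℚ                      ≡⟨ powℚ-1 N ⟨
    powℚ (½ * 2ℚ) N         ≡⟨ powℚ-* ½ 2ℚ N ⟩
    powℚ ½ N * powℚ 2ℚ N    ≡⟨ cong (powℚ ½ N *_) (ι-^ 2 N) ⟨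
    powℚ ½ N * ι (2 ℕ.^ N)  ∎
    where open ≡-Reasoning

-- The integer form of p ≥ c · M^(-l/k). The hypothesis on `M` says that 2^(-r) is at least
-- M^(-l/k); it enters as a factor that is at least 1.
powℚ-bound : ∀ k l r M c p → 0ℚ ≤ c → c * powℚ ½ r ≤ p → 2 ℕ.^ (k ℕ.* r) ℕ.≤ M ℕ.^ l →
  powℚ c k ≤ powℚ p k * powℚ (+ M / 1) l
powℚ-bound k l r M c p 0≤c le big = begin
  powℚ c k
    ≡⟨ *-identityʳ (powℚ c k) ⟨
  powℚ c k * 1ℚ
    ≤⟨ ℚₚ.*-monoˡ-≤-nonNeg (powℚ c k) {{nonNegative (powℚ-nonNeg k 0≤c)}} (1≤½^*ι (k ℕ.* r) (M ℕ.^ l) big) ⟩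
  powℚ c k * (powℚ ½ (k ℕ.* r) * ι (M ℕ.^ l))
    ≡⟨ *-assoc (powℚ c k) (powℚ ½ (k ℕ.* r)) (ι (M ℕ.^ l)) ⟨
  powℚ c k * powℚ ½ (k ℕ.* r) * ι (M ℕ.^ l)
    ≡⟨ cong₂ _*_ (trans (cong (powℚ c k *_) (sym (powℚ-powℚ ½ r k))) (sym (powℚ-* c (powℚ ½ r) k))) (ι-^ M l) ⟩
  powℚ (c * powℚ ½ r) k * powℚ (ι M) l
    ≤⟨ ℚₚ.*-monoʳ-≤-nonNeg (powℚ (ι M) l) {{nonNegative (powℚ-nonNeg l (ι-mono {0} {M} ℕ.z≤n))}}
         (powℚ-mono k (*-nonNeg 0≤c (powℚ-nonNeg r 0≤½)) le) ⟩
  powℚ p k * powℚ (ι M) l ∎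
  where open ℚₚ.≤-Reasoning

-- Each of `a` and `b` is spent twice, once on path vertices and once on their siblings. Four
-- factors of at most m^10 give m^40.
height-budget : ∀ a b m → 2 ℕ.^ (49 ℕ.* a) ℕ.≤ m ℕ.^ 10 → 2 ℕ.^ (49 ℕ.* b) ℕ.≤ m ℕ.^ 10 →
  2 ℕ.^ (49 ℕ.* ((a ℕ.+ b) ℕ.+ (a ℕ.+ b))) ℕ.≤ m ℕ.^ 40
height-budget a b m ha hb = subst₂ ℕ._≤_ (sym (split (a ℕ.+ b) (a ℕ.+ b))) (sym (ℕₚ.^-distribˡ-+-* m 20 20))
    (ℕₚ.*-mono-≤ both both)
  where
  split : ∀ x y → 2 ℕ.^ (49 ℕ.* (x ℕ.+ y)) ≡ 2 ℕ.^ (49 ℕ.* x) ℕ.* 2 ℕ.^ (49 ℕ.* y)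
  split x y = trans (cong (2 ℕ.^_) (ℕₚ.*-distribˡ-+ 49 x y)) (ℕₚ.^-distribˡ-+-* 2 (49 ℕ.* x) (49 ℕ.* y))
  both : 2 ℕ.^ (49 ℕ.* (a ℕ.+ b)) ℕ.≤ m ℕ.^ 20
  both = subst₂ ℕ._≤_ (sym (split a b)) (sym (ℕₚ.^-distribˡ-+-* m 10 10)) (ℕₚ.*-mono-≤ ha hb)

-- Boolean quantifiers

module _ {a b : Bool} where
  ∧⁻ : T (a ∧ b) → T a × T b
  ∧⁻ = Equivalence.to T-∧
  ∧⁺ : T a × T b → T (a ∧ b)
  ∧⁺ = Equivalence.from T-∧
  ∨⁻ : T (a ∨ b) → T a ⊎ T b
  ∨⁻ = Equivalence.to T-∨
  ∨⁺ : T a ⊎ T b → T (a ∨ b)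
  ∨⁺ = Equivalence.from T-∨

not⁻ : ∀ {a} → T (not a) → ¬ T a
not⁻ {false} _ ()

not⁺ : ∀ {a} → ¬ T a → T (not a)
not⁺ {true}  n = n _
not⁺ {false} n = _

¬T⇒false : ∀ {a} → ¬ T a → a ≡ false
¬T⇒false {true}  n = ⊥-elim (n _)
¬T⇒false {false} n = refl

false⇒¬T : ∀ {a} → a ≡ false → ¬ T a
false⇒¬T refl ()

∧-congʳ : ∀ a {b c} → (T a → b ≡ c) → a ∧ b ≡ a ∧ c
∧-congʳ true  e = e _
∧-congʳ false e = refl

module _ {A : Set} where
  all⁻ : ∀ (p : A → Bool) xs → T (all p xs) → All (T ∘ p) xs
  all⁻ p []       t = []
  all⁻ p (x ∷ xs) t = proj₁ (∧⁻ t) ∷ all⁻ p xs (proj₂ (∧⁻ {p x} t))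

  all⁺ : ∀ (p : A → Bool) {xs} → All (T ∘ p) xs → T (all p xs)
  all⁺ p []       = _
  all⁺ p (t ∷ ts) = ∧⁺ (t , all⁺ p ts)

  all-refute : ∀ (p : A → Bool) xs → ¬ T (all p xs) → Any (λ x → ¬ T (p x)) xs
  all-refute p []       n = ⊥-elim (n _)
  all-refute p (x ∷ xs) n with T? (p x)
  ... | yes t = there (all-refute p xs (λ ts → n (∧⁺ (t , ts))))
  ... | no ¬t = here ¬t

  all-cong : ∀ {p q : A → Bool} {xs} → All (λ x → p x ≡ q x) xs → all p xs ≡ all q xs
  all-cong []       = refl
  all-cong (e ∷ es) = cong₂ _∧_ e (all-cong es)

  any-cong : ∀ {p q : A → Bool} {xs} → All (λ x → p x ≡ q x) xs → any p xs ≡ any q xs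
  any-cong []       = refl
  any-cong (e ∷ es) = cong₂ _∨_ e (any-cong es)

  any-refute : ∀ {p : A → Bool} {xs} → All (λ x → ¬ T (p x)) xs → any p xs ≡ false
  any-refute []       = refl
  any-refute (n ∷ ns) = cong₂ _∨_ (¬T⇒false n) (any-refute ns)

module _ {k : ℕ} where
  allFin-cong : ∀ {p q : Fin k → Bool} → p ≗ q → all p (allFin k) ≡ all q (allFin k)
  allFin-cong e = all-cong (Allₚ.tabulate⁺ e)

  allFin⁻ : ∀ (p : Fin k → Bool) → T (all p (allFin k)) → ∀ v → T (p v)
  allFin⁻ p t v = All.lookup (all⁻ p (allFin k) t) (∈-allFin v)

  allFin⁺ : ∀ (p : Fin k → Bool) → (∀ v → T (p v)) → T (all p (allFin k))
  allFin⁺ p f = all⁺ p (Allₚ.tabulate⁺ f)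

  anyFin⁻ : ∀ (p : Fin k → Bool) → T (any p (allFin k)) → ∃[ v ] T (p v)
  anyFin⁻ p t = satisfied (any⁻ p (allFin k) t)

  anyFin⁺ : ∀ (p : Fin k → Bool) v → T (p v) → T (any p (allFin k))
  anyFin⁺ p v t = any⁺ p (lose (∈-allFin v) t)

≟⁻ : ∀ {k} {u v : Fin k} → T (⌊ u ≟ v ⌋) → u ≡ v
≟⁻ {u = u} {v} = toWitness {a? = u ≟ v}

≟⁺ : ∀ {k} {u v : Fin k} → u ≡ v → T (⌊ u ≟ v ⌋)
≟⁺ {u = u} {v} = fromWitness {a? = u ≟ v}

-- The law Pr as the image of the uniform measure

module Forcing (H : Raw) where
  open Raw H

  -- This is the condition in `inFix` without the demand that `v` be positive: whether `v` is forced
  -- must not depend on the bit of `v` itself.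
  forcedBy : Bits n → Fin n → PE H → Bool
  forcedBy σ v (i , j , ℓ) = (_==_ H ℓ v) ∧
    all (λ w → not (onPath H i j ℓ w) ∨ (_==_ H w v) ∨ not (σ w)) (vertices H)

  forced : Bits n → Fin n → Bool
  forced σ v = any (forcedBy σ v) (pseudoedges H)

  inFix-forced : ∀ σ v → inFix H σ v ≡ σ v ∧ forced σ v
  inFix-forced σ v = cong (σ v ∧_) (any-cong {xs = pseudoedges H} (All.universal (λ _ → refl) _))

  forcedBy-cong : ∀ {σ τ} v i j ℓ → (ℓ ≡ v → ∀ w → T (onPath H i j ℓ w) → w ≢ v → σ w ≡ τ w) →
    forcedBy σ v (i , j , ℓ) ≡ forcedBy τ v (i , j , ℓ)
  forcedBy-cong {σ} {τ} v i j ℓ e = ∧-congʳ (_==_ H ℓ v) (λ t → allFin-cong (eq (≟⁻ t)))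
    where
    eq : ℓ ≡ v → ∀ w →
      (not (onPath H i j ℓ w) ∨ (_==_ H w v) ∨ not (σ w)) ≡ (not (onPath H i j ℓ w) ∨ (_==_ H w v) ∨ not (τ w))
    eq ℓ≡v w with onPath H i j ℓ w in on | w ≟ v
    ... | false | _      = refl
    ... | true  | yes _  = refl
    ... | true  | no w≢v = cong not (e ℓ≡v w (subst T (sym on) _) w≢v)

  forced-ext : ∀ v → Ext (λ σ → forced σ v)
  forced-ext v e = any-cong (All.universal (λ { (i , j , ℓ) → forcedBy-cong v i j ℓ (λ _ w _ _ → e w) }) (pseudoedges H))

  anc-refl : ∀ i v → T (anc H i v v)
  anc-refl i v = any⁺ (λ k → _==_ H (iter H i k v) v) (lose (∈-upTo⁺ {suc n} (ℕ.s≤s ℕ.z≤n)) (≟⁺ refl))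

  satφ-forced : ∀ σ v → T (satφ H σ) → T (forced σ v) → T (σ v)
  satφ-forced σ v sat f with find (any⁻ (forcedBy σ v) (pseudoedges H) f)
  ... | (i , j , ℓ) , e∈ , t
    with anyFin⁻ _ (All.lookup (all⁻ (clauseSat H σ) (pseudoedges H) sat) e∈)
  ... | w , on∧σw with ∧⁻ {onPath H i j ℓ w} on∧σw
  ... | on , σw with ∨⁻ {not (onPath H i j ℓ w)} (allFin⁻ _ (proj₂ (∧⁻ {_==_ H ℓ v} t)) w)
  ... | inj₁ off = ⊥-elim (not⁻ off on)
  ... | inj₂ rest with ∨⁻ {_==_ H w v} rest
  ... | inj₁ w=v = subst (T ∘ σ) (≟⁻ w=v) σw
  ... | inj₂ ¬σw = ⊥-elim (not⁻ ¬σw σw)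

  unsat-forced : ∀ σ → ¬ T (satφ H σ) → ∃[ v ] (T (forced σ v) × ¬ T (σ v))
  unsat-forced σ n with find (all-refute (clauseSat H σ) (pseudoedges H) n)
  ... | (i , j , ℓ) , e∈ , unsat = ℓ , any⁺ (forcedBy σ ℓ) (lose e∈ (∧⁺ (≟⁺ {u = ℓ} refl , allFin⁺ _ off))) ,
      (λ σℓ → unsat (anyFin⁺ _ ℓ (∧⁺ {onPath H i j ℓ ℓ} (∨⁺ (inj₁ (anc-refl i ℓ)) , σℓ))))
    where
    off : ∀ w → T (not (onPath H i j ℓ w) ∨ (_==_ H w ℓ) ∨ not (σ w))
    off w with T? (onPath H i j ℓ w)
    ... | no ¬on = ∨⁺ (inj₁ (not⁺ ¬on))
    ... | yes on = ∨⁺ {not (onPath H i j ℓ w)} (inj₂ (∨⁺ {_==_ H w ℓ}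
                     (inj₂ (not⁺ (λ σw → unsat (anyFin⁺ _ w (∧⁺ (on , σw))))))))

  density : Bits n → ℚ
  density σ = ∏ (λ v → tilt (forced σ v) (σ v))

  -- On a satisfying assignment every forced variable is positive, so no factor vanishes and the
  -- factors 2 count `Fix`. In a violated clause the leaf is forced but negative, which contributes
  -- a factor 0. Hence the density also encodes membership in SAT.
  weight-density : ∀ σ → 𝟙 (satφ H σ) * weight H σ ≡ powℚ ½ n * density σ
  weight-density σ with T? (satφ H σ)
  ... | yes sat = begin
    𝟙 (satφ H σ) * weight H σ
      ≡⟨ cong (λ b → 𝟙 b * weight H σ) (Equivalence.to T-≡ sat) ⟩
    1ℚ * weight H σ
      ≡⟨ *-identityˡ (weight H σ) ⟩
    weight H σ
      ≡⟨ subst (λ l → powℚ ½ (l ∸ fixSize H σ) ≡ powℚ ½ l * foldr _*_ 1ℚ (map fixFactor (vertices H)))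
           (length-tabulate {n = n} id) (½^-∸ (inFix H σ) (vertices H)) ⟩
    powℚ ½ n * foldr _*_ 1ℚ (map fixFactor (vertices H))
      ≡⟨ cong (λ xs → powℚ ½ n * foldr _*_ 1ℚ xs) (map-tabulate id fixFactor) ⟩
    powℚ ½ n * ∏ fixFactor
      ≡⟨ cong (powℚ ½ n *_) (∏-cong same) ⟩
    powℚ ½ n * density σ ∎
    where
    open ≡-Reasoning
    fixFactor : Fin n → ℚ
    fixFactor v = if inFix H σ v then 2ℚ else 1ℚ
    same′ : ∀ s f → (T f → T s) → (if s ∧ f then 2ℚ else 1ℚ) ≡ tilt f s
    same′ true  true  g = refl
    same′ true  false g = refl
    same′ false true  g = ⊥-elim (g _)
    same′ false false g = refl
    same : fixFactor ≗ (λ v → tilt (forced σ v) (σ v))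
    same v = trans (cong (λ b → if b then 2ℚ else 1ℚ) (inFix-forced σ v))
      (same′ (σ v) (forced σ v) (satφ-forced σ v sat))
  ... | no ¬sat with unsat-forced σ ¬sat
  ... | v , f , ¬σv = begin
    𝟙 (satφ H σ) * weight H σ
      ≡⟨ cong (λ b → 𝟙 b * weight H σ) (¬T⇒false ¬sat) ⟩
    0ℚ * weight H σ
      ≡⟨ *-zeroˡ (weight H σ) ⟩
    0ℚ
      ≡⟨ *-zeroʳ (powℚ ½ n) ⟨
    powℚ ½ n * 0ℚ
      ≡⟨ cong (powℚ ½ n *_) (∏-zero v (cong₂ tilt (Equivalence.to T-≡ f) (¬T⇒false ¬σv))) ⟨
    powℚ ½ n * density σ ∎
    where open ≡-Reasoning

  density-ext : Ext density
  density-ext e = ∏-cong (λ v → cong₂ tilt (forced-ext v e) (e v))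

  Pr-density : ∀ (E : Bits n → Bool) → Ext E → Pr H E ≡ 𝔼 (λ σ → 𝟙 (E σ) * density σ)
  Pr-density E ext = begin
    Pr H E
      ≡⟨ sumL-filter E (weight H) (SAT H) ⟩
    sumL (λ σ → 𝟙 (E σ) * weight H σ) (SAT H)
      ≡⟨ sumL-filter (satφ H) (λ σ → 𝟙 (E σ) * weight H σ) (assignments H n) ⟩
    sumL (λ σ → 𝟙 (satφ H σ) * (𝟙 (E σ) * weight H σ)) (assignments H n)
      ≡⟨ sumL-cong regroup (assignments H n) ⟩
    sumL (λ σ → powℚ ½ n * (𝟙 (E σ) * density σ)) (assignments H n)
      ≡⟨ sumL-assignments H n (λ σ → 𝟙 (E σ) * density σ) (λ e → cong₂ _*_ (cong 𝟙 (ext e)) (density-ext e)) ⟩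
    𝔼 (λ σ → 𝟙 (E σ) * density σ) ∎
    where
    open ≡-Reasoning
    swap : ∀ x y z → x * (y * z) ≡ y * (x * z)
    swap = solve 3 (λ x y z → x :* (y :* z) := y :* (x :* z)) refl
      where open +-*-Solver
    regroup : ∀ σ → 𝟙 (satφ H σ) * (𝟙 (E σ) * weight H σ) ≡ powℚ ½ n * (𝟙 (E σ) * density σ)
    regroup σ = trans (swap (𝟙 (satφ H σ)) (𝟙 (E σ)) (weight H σ))
      (trans (cong (𝟙 (E σ) *_) (weight-density σ)) (swap (𝟙 (E σ)) (powℚ ½ n) (density σ)))

  force : Bits n → Bits n
  force τ v = τ v ∨ forced τ v

  -- Pr is the law of force τ for a uniform τ, provided the variables that can
  -- be forced (those of L) do not influence which variables are forced.
  module _ (L : Bits n)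
           (forced-dep : ∀ v → DependsOn (λ w → L w ≡ false) (λ σ → forced σ v))
           (unforced : ∀ σ v → L v ≡ false → forced σ v ≡ false) where

    forced-mix : ∀ ρ σ v → forced (mix L ρ σ) v ≡ forced ρ v
    forced-mix ρ σ v = forced-dep v (λ w e → cong (λ b → if b then σ w else ρ w) e)

    -- Outside `L` nothing is forced, so the factor is 1 whichever sample supplies the bit. The
    -- forcing pattern then comes from `ρ` alone and the tilted bits from `σ` alone.
    tilt-mix : ∀ ρ σ v → tilt (forced (mix L ρ σ) v) (mix L ρ σ v) ≡ tilt (forced ρ v) (σ v)
    tilt-mix ρ σ v with L v in eq
    ... | true  = cong (λ c → tilt c (σ v)) (forced-mix ρ σ v)
    ... | false = trans (cong (λ c → tilt c (ρ v)) (unforced (mix L ρ σ) v eq))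
                        (sym (cong (λ c → tilt c (σ v)) (unforced ρ v eq)))

    force-mix : ∀ ρ τ → mix L ρ (λ v → τ v ∨ forced ρ v) ≗ force (mix L ρ τ)
    force-mix ρ τ v with L v in eq
    ... | true  = cong (τ v ∨_) (sym (forced-mix ρ τ v))
    ... | false = sym (trans (cong (ρ v ∨_) (unforced (mix L ρ τ) v eq)) (∨-identityʳ (ρ v)))

    force-ext : ∀ {A : Set} {F : Bits n → A} → Ext F → Ext (F ∘ force)
    force-ext ext e = ext (λ v → cong₂ _∨_ (e v) (forced-ext v e))

    mix-ext : ∀ {A : Set} {F : Bits n → A} ρ → Ext F → Ext (F ∘ mix L ρ)
    mix-ext ρ ext e = ext (λ v → cong (λ b → if L v then b else ρ v) (e v))

    Pr-force : ∀ (E : Bits n → Bool) → Ext E → Pr H E ≡ 𝔼 (λ τ → 𝟙 (E (force τ)))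
    Pr-force E ext = begin
      Pr H E
        ≡⟨ Pr-density E ext ⟩
      𝔼 (λ σ → 𝟙 (E σ) * density σ)
        ≡⟨ 𝔼-mix L _ (λ e → cong₂ _*_ (cong 𝟙 (ext e)) (density-ext e)) ⟩
      𝔼 (λ ρ → 𝔼 (λ σ → 𝟙 (E (mix L ρ σ)) * density (mix L ρ σ)))
        ≡⟨ 𝔼-cong (λ ρ → 𝔼-cong (λ σ → cong (𝟙 (E (mix L ρ σ)) *_) (∏-cong (tilt-mix ρ σ)))) ⟩
      𝔼 (λ ρ → 𝔼 (λ σ → 𝟙 (E (mix L ρ σ)) * ∏ (λ v → tilt (forced ρ v) (σ v))))
        -- With `ρ` fixed, `forced ρ` is a constant pattern, as `𝔼-tilt` demands.
        ≡⟨ 𝔼-cong (λ ρ → 𝔼-tilt (forced ρ) (λ σ → 𝟙 (E (mix L ρ σ))) (mix-ext ρ (cong 𝟙 ∘ ext))) ⟩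
      𝔼 (λ ρ → 𝔼 (λ τ → 𝟙 (E (mix L ρ (λ v → τ v ∨ forced ρ v)))))
        ≡⟨ 𝔼-cong (λ ρ → 𝔼-cong (λ τ → cong 𝟙 (ext (force-mix ρ τ)))) ⟩
      𝔼 (λ ρ → 𝔼 (λ τ → 𝟙 (E (force (mix L ρ τ)))))
        ≡⟨ 𝔼-mix L (λ τ → 𝟙 (E (force τ))) (force-ext (cong 𝟙 ∘ ext)) ⟨
      𝔼 (λ τ → 𝟙 (E (force τ))) ∎
      where open ≡-Reasoning

-- Trees, pseudoedges and independence

module Tree (H : Raw) (btg : IsBTG H) where
  open Raw H
  open IsBTG btg
  open Forcing H

  nonroot⁻ : ∀ i v → T (nonroot H i v) → T (mem i v) × v ≢ root i
  nonroot⁻ i v t = proj₁ (∧⁻ t) , λ e → not⁻ (proj₂ (∧⁻ {mem i v} t)) (≟⁺ e)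

  nonroot⁺ : ∀ i v → T (mem i v) → v ≢ root i → T (nonroot H i v)
  nonroot⁺ i v t ne = ∧⁺ (t , not⁺ (ne ∘ ≟⁻))

  leaf⇒mem : ∀ i v → T (leaf H i v) → T (mem i v)
  leaf⇒mem i v t = proj₁ (∧⁻ t)

  par-notLeaf : ∀ i v → T (nonroot H i v) → ¬ T (leaf H i (par i v))
  par-notLeaf i v t l = not⁻ (proj₂ (∧⁻ {mem i (par i v)} l)) (anyFin⁺ _ v (∧⁺ (t , ≟⁺ {u = par i v} refl)))

  data StepCase (i : Fin m) (v : Fin n) : Set where
    stop : v ≡ root i → step H i v ≡ v → StepCase i v
    move : v ≢ root i → step H i v ≡ par i v → StepCase i v

  stepCase : ∀ i v → StepCase i v
  stepCase i v with v ≟ root i in eq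
  ... | yes e = stop e (cong (λ d → if ⌊ d ⌋ then v else par i v) eq)
  ... | no ne = move ne (cong (λ d → if ⌊ d ⌋ then v else par i v) eq)

  step-root : ∀ i → step H i (root i) ≡ root i
  step-root i with stepCase i (root i)
  ... | stop _ e  = e
  ... | move ne _ = ⊥-elim (ne refl)

  step-mem : ∀ i v → T (mem i v) → T (mem i (step H i v))
  step-mem i v t with stepCase i v
  ... | stop _ e  = subst (T ∘ mem i) (sym e) t
  ... | move ne e = subst (T ∘ mem i) (sym e) (proj₁ (proj₂ (trees i)) v (nonroot⁺ i v t ne))

  iter-mem : ∀ i k v → T (mem i v) → T (mem i (iter H i k v))
  iter-mem i zero    v t = t
  iter-mem i (suc k) v t = step-mem i _ (iter-mem i k v t)

  iter-root : ∀ i k → iter H i k (root i) ≡ root i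
  iter-root i zero    = refl
  iter-root i (suc k) = trans (cong (step H i) (iter-root i k)) (step-root i)

  iter-+ : ∀ i a b v → iter H i (a ℕ.+ b) v ≡ iter H i a (iter H i b v)
  iter-+ i zero    b v = refl
  iter-+ i (suc a) b v = cong (step H i) (iter-+ i a b v)

  iter-stable : ∀ i {a b} v → a ℕ.≤ b → iter H i a v ≡ root i → iter H i b v ≡ root i
  iter-stable i {a} {b} v a≤b e = begin
    iter H i b v                      ≡⟨ cong (λ k → iter H i k v) (ℕₚ.m∸n+n≡m a≤b) ⟨
    iter H i (b ∸ a ℕ.+ a) v          ≡⟨ iter-+ i (b ∸ a) a v ⟩
    iter H i (b ∸ a) (iter H i a v)   ≡⟨ cong (iter H i (b ∸ a)) e ⟩
    iter H i (b ∸ a) (root i)         ≡⟨ iter-root i (b ∸ a) ⟩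
    root i                            ∎
    where open ≡-Reasoning

  periodic : ∀ i c v → iter H i c v ≡ v → ∀ q → iter H i (q ℕ.* c) v ≡ v
  periodic i c v e zero    = refl
  periodic i c v e (suc q) = trans (iter-+ i c (q ℕ.* c) v) (trans (cong (iter H i c) (periodic i c v e q)) e)

  -- If the root is reached after k steps, it is still there after k(c + 1) steps, while periodicity
  -- puts `v` itself there.
  cycle⇒root : ∀ i c v → T (mem i v) → iter H i (suc c) v ≡ v → v ≡ root i
  cycle⇒root i c v t e with proj₂ (proj₂ (trees i)) v t
  ... | k , r = trans (sym (periodic i (suc c) v e k))
                      (iter-stable i v (ℕₚ.m≤m*n k (suc c)) r)

  -- A step that moves arrives at a parent, which has a child. The first alternative covers the
  -- start as well as a root, where all iterates stay put.
  iter-notLeaf : ∀ i k v → T (mem i v) → iter H i k v ≡ v ⊎ ¬ T (leaf H i (iter H i k v))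
  iter-notLeaf i zero    v t = inj₁ refl
  iter-notLeaf i (suc k) v t with stepCase i (iter H i k v)
  ... | move ne e = inj₂ (subst (λ u → ¬ T (leaf H i u)) (sym e)
                      (par-notLeaf i _ (nonroot⁺ i _ (iter-mem i k v t) ne)))
  ... | stop _ e with iter-notLeaf i k v t
  ... | inj₁ e′ = inj₁ (trans e e′)
  ... | inj₂ nl = inj₂ (subst (λ u → ¬ T (leaf H i u)) (sym e) nl)

  anc⁻ : ∀ i x v → T (anc H i x v) → ∃[ k ] iter H i k x ≡ v
  anc⁻ i x v t with satisfied (any⁻ (λ k → _==_ H (iter H i k x) v) (upTo (suc n)) t)
  ... | k , e = k , ≟⁻ e

  anc⁺ : ∀ i x v k → k ℕ.≤ n → iter H i k x ≡ v → T (anc H i x v)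
  anc⁺ i x v k k≤n e = any⁺ (λ k → _==_ H (iter H i k x) v) (lose (∈-upTo⁺ {suc n} (ℕ.s≤s k≤n)) (≟⁺ e))

  -- `anc` searches only the first n steps, whereas the tree axiom gives no bound on the distance to
  -- the root. Among the iterates 0 to n two coincide; the earlier one lies on a cycle and is
  -- therefore the root.
  anc-root : ∀ i v → T (mem i v) → T (anc H i v (root i))
  anc-root i v t with Finₚ.pigeonhole (ℕₚ.n<1+n n) (λ (k : Fin (suc n)) → iter H i (toℕ k) v)
  ... | a , b , a<b , e = anc⁺ i v (root i) (toℕ a) (ℕₚ.≤-pred (Finₚ.toℕ<n a))
        (cycle⇒root i c u (iter-mem i (toℕ a) v t) period)
    where
    u = iter H i (toℕ a) v
    c = toℕ b ∸ suc (toℕ a)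
    shift : suc c ℕ.+ toℕ a ≡ toℕ b
    shift = trans (sym (ℕₚ.+-suc c (toℕ a))) (ℕₚ.m∸n+n≡m a<b)
    period : iter H i (suc c) u ≡ u
    period = trans (sym (iter-+ i (suc c) (toℕ a) v)) (trans (cong (λ k → iter H i k v) shift) (sym e))

  anc-mem : ∀ i x v → T (mem i x) → T (anc H i x v) → T (mem i v)
  anc-mem i x v t a with anc⁻ i x v a
  ... | k , e = subst (T ∘ mem i) e (iter-mem i k x t)

  anc-notLeaf : ∀ i x v → T (mem i x) → T (anc H i x v) → v ≡ x ⊎ ¬ T (leaf H i v)
  anc-notLeaf i x v t a with anc⁻ i x v a
  ... | k , refl = iter-notLeaf i k x t

  leaf-mem⇒leaf : ∀ i j v → T (leaf H i v) → T (mem j v) → T (leaf H j v)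
  leaf-mem⇒leaf i j v l t with i ≟ j
  ... | yes refl = l
  ... | no i≢j   = proj₂ (shareLeaf i j v i≢j (leaf⇒mem i v l) t)

  leafVar⁻ : ∀ i v → T (mem i v) → T (leafVar H v) → T (leaf H i v)
  leafVar⁻ i v t l with anyFin⁻ _ l
  ... | j , lj = leaf-mem⇒leaf j i v lj t

  leafVar⁺ : ∀ i v → T (leaf H i v) → T (leafVar H v)
  leafVar⁺ i v l = anyFin⁺ (λ i → leaf H i v) i l

  nonleaf-tree : ∀ i j v → T (mem i v) → T (mem j v) → ¬ T (leafVar H v) → i ≡ j
  nonleaf-tree i j v ti tj nl with i ≟ j
  ... | yes e = e
  ... | no ne = ⊥-elim (nl (leafVar⁺ i v (proj₁ (shareLeaf i j v ne ti tj))))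

  sib⁻ : ∀ i v w → T (sibIn H i v w) → T (nonroot H i v) × T (nonroot H i w) × v ≢ w × par i v ≡ par i w
  sib⁻ i v w s with ∧⁻ {nonroot H i v} s
  ... | nv , s′ with ∧⁻ {nonroot H i w} s′
  ... | nw , s″ with ∧⁻ {not (_==_ H v w)} s″
  ... | v≠w , p = nv , nw , (λ e → not⁻ v≠w (≟⁺ e)) , ≟⁻ p

  -- Siblings take the same step, so a path through both would close a cycle below the root.
  sib-anc : ∀ i x v w → T (sibIn H i v w) → T (anc H i x v) → ¬ T (anc H i x w)
  sib-anc i x v w s av aw with anc⁻ i x v av | anc⁻ i x w aw
  ... | a , ea | b , eb with sib⁻ i v w s
  ... | nv , nw , v≢w , par≡ = go (ℕₚ.≤-total a b)
    where
    step≡ : step H i v ≡ step H i w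
    step≡ with stepCase i v | stepCase i w
    ... | move _ e | move _ f = trans e (trans par≡ (sym f))
    ... | stop e _ | _        = ⊥-elim (proj₂ (nonroot⁻ i v nv) e)
    ... | move _ _ | stop e _ = ⊥-elim (proj₂ (nonroot⁻ i w nw) e)
    noPath : ∀ {u u′} c → T (nonroot H i u′) → u ≢ u′ → step H i u ≡ step H i u′ → iter H i c u ≢ u′
    noPath zero    nr ne st e = ne e
    noPath {u} {u′} (suc c) nr ne st e = proj₂ (nonroot⁻ i u′ nr)
      (cycle⇒root i c u′ (proj₁ (nonroot⁻ i u′ nr)) (trans (shift u′) (trans (cong (iter H i c) (sym st)) (trans (sym (shift u)) e))))
      where
      shift : ∀ z → iter H i (suc c) z ≡ iter H i c (step H i z)
      shift z = trans (cong (λ k → iter H i k z) (ℕₚ.+-comm 1 c)) (iter-+ i c 1 z)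
    between : ∀ {a b u u′} → a ℕ.≤ b → iter H i a x ≡ u → iter H i b x ≡ u′ → iter H i (b ∸ a) u ≡ u′
    between {a} {b} a≤b refl e = trans (sym (iter-+ i (b ∸ a) a x)) (trans (cong (λ k → iter H i k x) (ℕₚ.m∸n+n≡m a≤b)) e)
    go : a ℕ.≤ b ⊎ b ℕ.≤ a → ⊥
    go (inj₁ a≤b) = noPath (b ∸ a) nw v≢w step≡ (between a≤b ea eb)
    go (inj₂ b≤a) = noPath (a ∸ b) nv (v≢w ∘ sym) (sym step≡) (between b≤a eb ea)

  -- Pseudoedges, their clauses, and the bits that `X` reads

  pseudoedge⁻ : ∀ i j ℓ → T (isPseudoedge H i j ℓ) → IsPseudoedge H i j ℓ
  pseudoedge⁻ i j ℓ t with ∧⁻ {not ⌊ i ≟ j ⌋} t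
  ... | ne , ls = (λ e → not⁻ ne (≟⁺ e)) , ∧⁻ ls

  all-pseudoedges : All (λ { (i , j , ℓ) → IsPseudoedge H i j ℓ }) (pseudoedges H)
  all-pseudoedges = All.map (λ { {i , j , ℓ} → pseudoedge⁻ i j ℓ }) (Allₚ.all-filter _ (allPE H))

  -- Deliberately larger than the path: `ℓ` together with all nonleaf vertices of both trees.
  -- Internal siblings of path vertices are thus included, and for pseudoedges with disjoint ends
  -- these sets are disjoint.
  record PathVertex (i j : Fin m) (ℓ v : Fin n) : Set where
    field
      inTree  : T (mem i v) ⊎ T (mem j v)
      nonleaf : v ≡ ℓ ⊎ ¬ T (leafVar H v)

  path-vertex : ∀ i j ℓ v → IsPseudoedge H i j ℓ → T (onPath H i j ℓ v) → PathVertex i j ℓ v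
  path-vertex i j ℓ v (_ , li , lj) on with ∨⁻ {anc H i ℓ v} on
  ... | inj₁ a = record { inTree = inj₁ t ; nonleaf = Sum.map₂ (λ nl → nl ∘ leafVar⁻ i v t) (anc-notLeaf i ℓ v (leaf⇒mem i ℓ li) a) }
    where t = anc-mem i ℓ v (leaf⇒mem i ℓ li) a
  ... | inj₂ a = record { inTree = inj₂ t ; nonleaf = Sum.map₂ (λ nl → nl ∘ leafVar⁻ j v t) (anc-notLeaf j ℓ v (leaf⇒mem j ℓ lj) a) }
    where t = anc-mem j ℓ v (leaf⇒mem j ℓ lj) a

  leaf-trees : ∀ i j k ℓ → IsPseudoedge H i j ℓ → T (leaf H k ℓ) → k ≡ i ⊎ k ≡ j
  leaf-trees i j k ℓ (i≢j , li , lj) lk with leafTwo i ℓ li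
  ... | j′ , _ , _ , only with only j lj | only k lk
  ... | inj₁ j≡i  | _         = ⊥-elim (i≢j (sym j≡i))
  ... | inj₂ _    | inj₁ k≡i  = inj₁ k≡i
  ... | inj₂ j≡j′ | inj₂ k≡j′ = inj₂ (trans k≡j′ (sym j≡j′))

  -- A leaf determines its two trees, so two pseudoedges through `ℓ` differ at most in the order of
  -- their ends. This makes the forcing of `ℓ` a matter of one clause.
  onPath-unique : ∀ i j a b ℓ → IsPseudoedge H i j ℓ → IsPseudoedge H a b ℓ →
    ∀ v → onPath H a b ℓ v ≡ onPath H i j ℓ v
  onPath-unique i j a b ℓ e (a≢b , la , lb) v with leaf-trees i j a ℓ e la | leaf-trees i j b ℓ e lb
  ... | inj₁ refl | inj₂ refl = refl
  ... | inj₂ refl | inj₁ refl = ∨-comm (anc H j ℓ v) (anc H i ℓ v)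
  ... | inj₁ refl | inj₁ refl = ⊥-elim (a≢b refl)
  ... | inj₂ refl | inj₂ refl = ⊥-elim (a≢b refl)

  unforced : ∀ σ v → leafVar H v ≡ false → forced σ v ≡ false
  unforced σ v nl = any-refute (All.map (λ { {i , j , ℓ} (_ , li , _) t →
    false⇒¬T nl (leafVar⁺ i v (subst (T ∘ leaf H i) (≟⁻ (proj₁ (∧⁻ {_==_ H ℓ v} t))) li)) }) all-pseudoedges)

  -- The path of the clause through v meets the leaf variables in v only.
  forced-dep : ∀ v → DependsOn (λ w → leafVar H w ≡ false) (λ σ → forced σ v)
  forced-dep v {σ} {τ} e = any-cong (All.map (λ { {i , j , ℓ} pe → forcedBy-cong v i j ℓ (agree i j ℓ pe) }) all-pseudoedges)
    where
    agree : ∀ i j ℓ → IsPseudoedge H i j ℓ → ℓ ≡ v → ∀ w → T (onPath H i j ℓ w) → w ≢ v → σ w ≡ τ w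
    agree i j ℓ pe refl w on w≢ℓ with PathVertex.nonleaf (path-vertex i j ℓ w pe on)
    ... | inj₁ w≡ℓ = ⊥-elim (w≢ℓ w≡ℓ)
    ... | inj₂ nl  = e w (¬T⇒false nl)

  Pr-uniform : ∀ (E : Bits n → Bool) → Ext E → Pr H E ≡ 𝔼 (λ τ → 𝟙 (E (force τ)))
  Pr-uniform = Pr-force (leafVar H) forced-dep unforced

  internal⁻ : ∀ v → T (internalVar H v) → ¬ T (rootVar H v) × ¬ T (leafVar H v)
  internal⁻ v t with ∧⁻ {not (rootVar H v)} t
  ... | r , l = not⁻ r , not⁻ l

  rootVar⁺ : ∀ i → T (rootVar H (root i))
  rootVar⁺ i = anyFin⁺ (λ j → _==_ H (root j) (root i)) i (≟⁺ {u = root i} refl)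

  siblings⁻ : ∀ i v w → T (mem i v) → T (siblings H v w) →
    T (internalVar H v) × T (internalVar H w) × T (sibIn H i v w)
  siblings⁻ i v w t s with ∧⁻ {internalVar H v} s
  ... | iv , s′ with ∧⁻ {internalVar H w} s′
  ... | iw , s″ with anyFin⁻ _ s″
  ... | c , sc with nonleaf-tree c i v (proj₁ (nonroot⁻ c v (proj₁ (sib⁻ c v w sc)))) t (proj₂ (internal⁻ v iv))
  ... | refl = iv , iw , sc

  path-sibling : ∀ i j ℓ v w → IsPseudoedge H i j ℓ → T (onPath H i j ℓ v) → T (siblings H v w) → PathVertex i j ℓ w
  path-sibling i j ℓ v w pe on s with PathVertex.inTree (path-vertex i j ℓ v pe on)
  ... | inj₁ t with siblings⁻ i v w t s
  ... | _ , iw , si = record { inTree = inj₁ (proj₁ (nonroot⁻ i w (proj₁ (proj₂ (sib⁻ i v w si)))))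
                             ; nonleaf = inj₂ (proj₂ (internal⁻ w iw)) }
  path-sibling i j ℓ v w pe on s | inj₂ t with siblings⁻ j v w t s
  ... | _ , iw , sj = record { inTree = inj₂ (proj₁ (nonroot⁻ j w (proj₁ (proj₂ (sib⁻ j v w sj)))))
                             ; nonleaf = inj₂ (proj₂ (internal⁻ w iw)) }

  X-cong : ∀ i j ℓ {σ τ} →
    (∀ v → T (onPath H i j ℓ v) → σ v ≡ τ v) →
    (∀ v w → T (onPath H i j ℓ v) → T (siblings H v w) → σ w ≡ τ w) →
    X H (i , j , ℓ) σ ≡ X H (i , j , ℓ) τ
  X-cong i j ℓ {σ} {τ} e f = cong₂ _∧_ (allFin-cong path) (allFin-cong sibs)
    where
    path : ∀ v → (not (onPath H i j ℓ v) ∨ rootVar H v ∨ not (σ v)) ≡ (not (onPath H i j ℓ v) ∨ rootVar H v ∨ not (τ v))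
    path v with onPath H i j ℓ v in on
    ... | false = refl
    ... | true  = cong (λ b → rootVar H v ∨ not b) (e v (subst T (sym on) _))
    sibs : ∀ v → (not (onPath H i j ℓ v ∧ internalVar H v) ∨ all (λ w → not (siblings H v w) ∨ σ w) (vertices H))
               ≡ (not (onPath H i j ℓ v ∧ internalVar H v) ∨ all (λ w → not (siblings H v w) ∨ τ w) (vertices H))
    sibs v with onPath H i j ℓ v in on
    ... | false = refl
    ... | true  = cong (not (internalVar H v) ∨_) (allFin-cong sib)
      where
      sib : ∀ w → (not (siblings H v w) ∨ σ w) ≡ (not (siblings H v w) ∨ τ w)
      sib w with siblings H v w in s
      ... | false = refl
      ... | true  = f v w (subst T (sym on) _) (subst T (sym s) _)

  X-ext : ∀ e → Ext (X H e)
  X-ext (i , j , ℓ) e = X-cong i j ℓ (λ v _ → e v) (λ _ w _ _ → e w)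

  -- Nonleaf variables keep their own bit. For `ℓ`, every clause that could force it has the path of
  -- the given pseudoedge, whose vertices all belong to the set.
  force-dep : ∀ i j ℓ → IsPseudoedge H i j ℓ → ∀ v → PathVertex i j ℓ v → DependsOn (PathVertex i j ℓ) (λ τ → force τ v)
  force-dep i j ℓ pe v pv {σ} {τ} e = cong₂ _∨_ (e v pv) (eq (PathVertex.nonleaf pv))
    where
    eq : v ≡ ℓ ⊎ ¬ T (leafVar H v) → forced σ v ≡ forced τ v
    eq (inj₂ nl)   = trans (unforced σ v (¬T⇒false nl)) (sym (unforced τ v (¬T⇒false nl)))
    eq (inj₁ refl) = any-cong (All.map (λ { {a , b , ℓ′} pe′ → forcedBy-cong ℓ a b ℓ′ (agree a b ℓ′ pe′) }) all-pseudoedges)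
      where
      agree : ∀ a b ℓ′ → IsPseudoedge H a b ℓ′ → ℓ′ ≡ ℓ → ∀ w → T (onPath H a b ℓ′ w) → w ≢ ℓ → σ w ≡ τ w
      agree a b ℓ′ pe′ refl w on _ = e w (path-vertex i j ℓ w pe (subst T (onPath-unique i j a b ℓ pe pe′ w) on))

  X-dep : ∀ i j ℓ → IsPseudoedge H i j ℓ → DependsOn (PathVertex i j ℓ) (λ τ → X H (i , j , ℓ) (force τ))
  X-dep i j ℓ pe e = X-cong i j ℓ
    (λ v on → force-dep i j ℓ pe v (path-vertex i j ℓ v pe on) e)
    (λ v w on s → force-dep i j ℓ pe w (path-sibling i j ℓ v w pe on s) e)

  jointEvent-ext : ∀ M bs → Ext (jointEvent H M bs)
  jointEvent-ext []      bs       e = refl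
  jointEvent-ext (_ ∷ _) []       e = refl
  jointEvent-ext (x ∷ M) (b ∷ bs) e = cong₂ _∧_ (cong (_≡ᵇ b) (X-ext x e)) (jointEvent-ext M bs e)

  Within : (Fin n → Set) → PE H → Set
  Within S (i , j , ℓ) = IsPseudoedge H i j ℓ × (∀ v → PathVertex i j ℓ v → S v)

  jointEvent-dep : ∀ S M bs → All (Within S) M → DependsOn S (λ τ → jointEvent H M bs (force τ))
  jointEvent-dep S []      bs       _ e = refl
  jointEvent-dep S (_ ∷ _) []       _ e = refl
  jointEvent-dep S ((i , j , ℓ) ∷ M) (b ∷ bs) ((pe , sub) ∷ ws) e =
    cong₂ _∧_ (cong (_≡ᵇ b) (X-dep i j ℓ pe (λ v pv → e v (sub v pv)))) (jointEvent-dep S M bs ws e)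

  -- Trees meet in leaves only, and the leaf of a pseudoedge lies in its two trees only.
  disjoint-trees : ∀ c i j ℓ v → IsPseudoedge H i j ℓ → c ≢ i → c ≢ j → PathVertex i j ℓ v → ¬ T (mem c v)
  disjoint-trees c i j ℓ v pe@(_ , li , _) c≢i c≢j pv t with PathVertex.nonleaf pv
  ... | inj₁ refl with leaf-trees i j c ℓ pe (leaf-mem⇒leaf i c ℓ li t)
  ... | inj₁ c≡i = c≢i c≡i
  ... | inj₂ c≡j = c≢j c≡j
  disjoint-trees c i j ℓ v pe c≢i c≢j pv t | inj₂ nl with PathVertex.inTree pv
  ... | inj₁ ti = c≢i (nonleaf-tree c i v t ti nl)
  ... | inj₂ tj = c≢j (nonleaf-tree c j v t tj nl)

  -- The selector for `𝔼-indep`: the head of the matching reads bits where it is false, the rest of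
  -- the matching bits where it is true.
  outside : Fin m → Fin m → Bits n
  outside i j v = not (mem i v ∨ mem j v)

  ends-within : ∀ i j M → All (λ { (a , b , ℓ) → IsPseudoedge H a b ℓ }) M →
    All (i ≢_) (ends H M) → All (j ≢_) (ends H M) → All (Within (λ v → outside i j v ≡ true)) M
  ends-within i j [] [] _ _ = []
  ends-within i j ((a , b , ℓ) ∷ M) (pe ∷ pes) (i≢a ∷ i≢b ∷ is) (j≢a ∷ j≢b ∷ js) =
    (pe , (λ v pv → cong not (¬T⇒false (λ t → [ disjoint-trees i a b ℓ v pe i≢a i≢b pv
                                              , disjoint-trees j a b ℓ v pe j≢a j≢b pv ]′ (∨⁻ {mem i v} t)))))
    ∷ ends-within i j M pes is js

  𝟙-∧ : ∀ a b → 𝟙 (a ∧ b) ≡ 𝟙 a * 𝟙 b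
  𝟙-∧ true  b = sym (*-identityˡ (𝟙 b))
  𝟙-∧ false b = sym (*-zeroˡ (𝟙 b))

  independent : ∀ M → IsPseudomatching H M → MutuallyIndependent H M
  -- The empty product requires that Pr has total mass 1, which the change of variables provides.
  independent [] _ [] _ = trans (Pr-uniform (λ _ → true) (λ _ → refl)) (𝔼-const {n} 1ℚ)
  independent ((i , j , ℓ) ∷ M) (pe ∷ pes , (_ ∷ i≢) ∷ j≢ ∷ uniq) (b ∷ bs) len = begin
    Pr H (jointEvent H (e ∷ M) (b ∷ bs))
      ≡⟨ Pr-uniform _ (jointEvent-ext (e ∷ M) (b ∷ bs)) ⟩
    𝔼 (λ τ → 𝟙 ((X H e (force τ) ≡ᵇ b) ∧ jointEvent H M bs (force τ)))
      ≡⟨ 𝔼-cong (λ τ → 𝟙-∧ (X H e (force τ) ≡ᵇ b) (jointEvent H M bs (force τ))) ⟩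
    𝔼 (λ τ → 𝟙 (X H e (force τ) ≡ᵇ b) * 𝟙 (jointEvent H M bs (force τ)))
      ≡⟨ 𝔼-indep (outside i j)
           (λ eq → cong (λ x → 𝟙 (x ≡ᵇ b)) (X-dep i j ℓ pe (λ v pv → eq v (inside v pv))))
           (λ eq → cong 𝟙 (jointEvent-dep _ M bs (ends-within i j M pes i≢ j≢) eq)) ⟩
    𝔼 (λ τ → 𝟙 (X H e (force τ) ≡ᵇ b)) * 𝔼 (λ τ → 𝟙 (jointEvent H M bs (force τ)))
      ≡⟨ cong₂ _*_ (Pr-uniform _ (λ eq → cong (_≡ᵇ b) (X-ext e eq))) (Pr-uniform _ (jointEvent-ext M bs)) ⟨
    Pr H (λ σ → X H e σ ≡ᵇ b) * Pr H (jointEvent H M bs)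
      ≡⟨ cong (Pr H (λ σ → X H e σ ≡ᵇ b) *_) (independent M (pes , uniq) bs (ℕₚ.suc-injective len)) ⟩
    Pr H (λ σ → X H e σ ≡ᵇ b) * foldr _*_ 1ℚ (zipWith (λ e b → Pr H (λ σ → X H e σ ≡ᵇ b)) M bs) ∎
    where
    open ≡-Reasoning
    e : PE H
    e = i , j , ℓ
    inside : ∀ v → PathVertex i j ℓ v → outside i j v ≡ false
    inside v pv = cong not (Equivalence.to T-≡ (∨⁺ (PathVertex.inTree pv)))

-- The lower bound

∈-matches : ∀ {k} (b : Bits k) vs σ → T (matches b vs σ) → ∀ {v} → v ∈ vs → σ v ≡ b v
∈-matches b vs σ t v∈ = ≡ᵇ-true (All.lookup (all⁻ (λ v → σ v ≡ᵇ b v) vs t) v∈)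

𝟙-three : ∀ a b c x → (T a → T x) → (T b → T x) → (T c → T x) →
  (T a → T b → ⊥) → (T a → T c → ⊥) → (T b → T c → ⊥) → 𝟙 a + (𝟙 b + 𝟙 c) ≤ 𝟙 x
𝟙-three true  true  c     x ax bx cx ab ac bc = ⊥-elim (ab _ _)
𝟙-three true  false true  x ax bx cx ab ac bc = ⊥-elim (ac _ _)
𝟙-three true  false false x ax bx cx ab ac bc = 𝟙-mono {true} {x} ax
𝟙-three false true  true  x ax bx cx ab ac bc = ⊥-elim (bc _ _)
𝟙-three false true  false x ax bx cx ab ac bc = 𝟙-mono {true} {x} bx
𝟙-three false false true  x ax bx cx ab ac bc = 𝟙-mono {true} {x} cx
𝟙-three false false false x ax bx cx ab ac bc = 𝟙-nonNeg x

3ℚ : ℚ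
3ℚ = + 3 / 1

module Bound (H : Raw) (btg : IsBTG H) where
  open Raw H
  open IsBTG btg
  open Forcing H
  open Tree H btg

  -- The default `u` makes `branches` list a vertex without sibling twice, with one and the same
  -- demand; `𝔼-matches` tolerates this and the length stays uniform.
  sibling : Fin m → Fin n → Fin n
  sibling i u with T? (any (sibIn H i u) (allFin n))
  ... | yes t = proj₁ (anyFin⁻ (sibIn H i u) t)
  ... | no  _ = u

  sibling-unique : ∀ i u w → T (sibIn H i u w) → sibling i u ≡ w
  sibling-unique i u w s with T? (any (sibIn H i u) (allFin n))
  ... | no ¬t = ⊥-elim (¬t (anyFin⁺ (sibIn H i u) w s))
  ... | yes t with anyFin⁻ (sibIn H i u) t
  ... | w′ , s′ with sib⁻ i u w s | sib⁻ i u w′ s′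
  ... | nu , nw , u≢w , p | _ , nw′ , u≢w′ , p′
    with proj₁ (extended i) (par i u) u w w′
           (∧⁺ (nu , ≟⁺ {u = par i u} refl)) (∧⁺ (nw , ≟⁺ (sym p))) (∧⁺ (nw′ , ≟⁺ (sym p′)))
  ... | inj₁ e        = ⊥-elim (u≢w e)
  ... | inj₂ (inj₁ e) = ⊥-elim (u≢w′ e)
  ... | inj₂ (inj₂ e) = sym e

  branches : Fin m → Fin n → ℕ → List (Fin n)
  branches i ℓ zero    = []
  branches i ℓ (suc t) = iter H i (suc t) ℓ ∷ sibling i (iter H i (suc t) ℓ) ∷ branches i ℓ t

  length-branches : ∀ i ℓ t → length (branches i ℓ t) ≡ t ℕ.+ t
  length-branches i ℓ zero    = refl
  length-branches i ℓ (suc t) = cong suc (trans (cong suc (length-branches i ℓ t)) (sym (ℕₚ.+-suc t t)))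

  ∈-branches : ∀ i ℓ t a → suc a ℕ.≤ t →
    iter H i (suc a) ℓ ∈ branches i ℓ t × sibling i (iter H i (suc a) ℓ) ∈ branches i ℓ t
  ∈-branches i ℓ (suc t) a (ℕ.s≤s a≤t) with ℕₚ.m≤n⇒m<n∨m≡n a≤t
  ... | inj₂ refl = here refl , there (here refl)
  ... | inj₁ a<t with ∈-branches i ℓ t a a<t
  ... | v∈ , s∈ = there (there v∈) , there (there s∈)

  -- Step 0 is `ℓ`, and from step `k` on the iterate is the root, so only steps 1 to k - 1 remain.
  path∈branches : ∀ i ℓ k v → iter H i k ℓ ≡ root i → T (anc H i ℓ v) → ¬ T (rootVar H v) → v ≢ ℓ →
    v ∈ branches i ℓ (k ∸ 1) × sibling i v ∈ branches i ℓ (k ∸ 1)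
  path∈branches i ℓ k v top a nr v≢ℓ with anc⁻ i ℓ v a
  ... | zero  , e    = ⊥-elim (v≢ℓ (sym e))
  ... | suc a , refl = ∈-branches i ℓ (k ∸ 1) a (ℕₚ.∸-monoˡ-≤ 1 below)
    where
    below : suc (suc a) ℕ.≤ k
    below with ℕₚ.≤-total k (suc a)
    ... | inj₁ k≤ = ⊥-elim (nr (subst (T ∘ rootVar H) (sym (iter-stable i ℓ k≤ top)) (rootVar⁺ i)))
    ... | inj₂ ≤k with ℕₚ.m≤n⇒m<n∨m≡n ≤k
    ... | inj₁ lt   = lt
    ... | inj₂ refl = ⊥-elim (nr (subst (T ∘ rootVar H) (sym top) (rootVar⁺ i)))

  module _ (i j : Fin m) (ℓ : Fin n) (pe : IsPseudoedge H i j ℓ) (kᵢ kⱼ : ℕ)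
           (topᵢ : iter H i kᵢ ℓ ≡ root i) (topⱼ : iter H j kⱼ ℓ ≡ root j) where

    i≢j : i ≢ j
    i≢j = proj₁ pe

    ℓ∈ᵢ : T (mem i ℓ)
    ℓ∈ᵢ = leaf⇒mem i ℓ (proj₁ (proj₂ pe))

    ℓ∈ⱼ : T (mem j ℓ)
    ℓ∈ⱼ = leaf⇒mem j ℓ (proj₂ (proj₂ pe))

    path : Bits n
    path = onPath H i j ℓ

    constrained : List (Fin n)
    constrained = branches i ℓ (kᵢ ∸ 1) ++ branches j ℓ (kⱼ ∸ 1)

    ℓ-leafVar : T (leafVar H ℓ)
    ℓ-leafVar = leafVar⁺ i ℓ (proj₁ (proj₂ pe))

    path-constrained : ∀ v → T (path v) → ¬ T (rootVar H v) → v ≢ ℓ → v ∈ constrained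
    path-constrained v on nr v≢ℓ with ∨⁻ {anc H i ℓ v} on
    ... | inj₁ a = ∈-++⁺ˡ (proj₁ (path∈branches i ℓ kᵢ v topᵢ a nr v≢ℓ))
    ... | inj₂ a = ∈-++⁺ʳ (branches i ℓ (kᵢ ∸ 1)) (proj₁ (path∈branches j ℓ kⱼ v topⱼ a nr v≢ℓ))

    -- The sibling avoids the half of the path in its own tree by `sib-anc`, and the other half
    -- because an internal vertex lies in only one tree.
    sibling-constrained : ∀ v w → T (path v) → T (internalVar H v) → T (siblings H v w) →
      w ∈ constrained × ¬ T (path w) × ¬ T (rootVar H w)
    sibling-constrained v w on iv s with ∨⁻ {anc H i ℓ v} on
    ... | inj₁ a with siblings⁻ i v w (anc-mem i ℓ v ℓ∈ᵢ a) s
    ... | _ , iw , si =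
      ∈-++⁺ˡ (subst (_∈ branches i ℓ (kᵢ ∸ 1)) (sibling-unique i v w si)
        (proj₂ (path∈branches i ℓ kᵢ v topᵢ a (proj₁ (internal⁻ v iv)) v≢ℓ))) ,
      (λ on′ → [ sib-anc i ℓ v w si a
               , (λ a′ → i≢j (nonleaf-tree i j w w∈ (anc-mem j ℓ w ℓ∈ⱼ a′) (proj₂ (internal⁻ w iw)))) ]′
               (∨⁻ {anc H i ℓ w} on′)) ,
      proj₁ (internal⁻ w iw)
      where
      w∈ : T (mem i w)
      w∈ = proj₁ (nonroot⁻ i w (proj₁ (proj₂ (sib⁻ i v w si))))
      v≢ℓ : v ≢ ℓ
      v≢ℓ refl = proj₂ (internal⁻ v iv) ℓ-leafVar
    sibling-constrained v w on iv s | inj₂ a with siblings⁻ j v w (anc-mem j ℓ v ℓ∈ⱼ a) s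
    ... | _ , iw , sj =
      ∈-++⁺ʳ (branches i ℓ (kᵢ ∸ 1)) (subst (_∈ branches j ℓ (kⱼ ∸ 1)) (sibling-unique j v w sj)
        (proj₂ (path∈branches j ℓ kⱼ v topⱼ a (proj₁ (internal⁻ v iv)) v≢ℓ))) ,
      (λ on′ → [ (λ a′ → i≢j (nonleaf-tree i j w (anc-mem i ℓ w ℓ∈ᵢ a′) w∈ (proj₂ (internal⁻ w iw))))
               , sib-anc j ℓ v w sj a ]′
               (∨⁻ {anc H i ℓ w} on′)) ,
      proj₁ (internal⁻ w iw)
      where
      w∈ : T (mem j w)
      w∈ = proj₁ (nonroot⁻ j w (proj₁ (proj₂ (sib⁻ j v w sj))))
      v≢ℓ : v ≢ ℓ
      v≢ℓ refl = proj₂ (internal⁻ v iv) ℓ-leafVar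

    -- Since siblings lie off the path, the single rule `not (path v)` asks for negative path
    -- vertices and positive siblings alike. Roots are exempt: `kᵢ` and `kⱼ` need not be minimal, so
    -- `constrained` may contain them. The leaf has its own hypothesis because forcing can switch it
    -- on.
    respects-force : ∀ τ → (∀ v → v ∈ constrained → ¬ T (rootVar H v) → τ v ≡ not (path v)) →
      (¬ T (rootVar H ℓ) → ¬ T (force τ ℓ)) → T (X H (i , j , ℓ) (force τ))
    respects-force τ con off = ∧⁺ (allFin⁺ _ negative , allFin⁺ _ positive)
      where
      force-off : ∀ v → T (path v) → ¬ T (rootVar H v) → ¬ T (force τ v)
      force-off v on nr with v ≟ ℓ
      ... | yes refl = off nr
      ... | no v≢ℓ with PathVertex.nonleaf (path-vertex i j ℓ v pe on)
      ... | inj₁ v≡ℓ = ⊥-elim (v≢ℓ v≡ℓ)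
      ... | inj₂ nl  = false⇒¬T (cong₂ _∨_
              (trans (con v (path-constrained v on nr v≢ℓ) nr) (cong not (Equivalence.to T-≡ on)))
              (unforced τ v (¬T⇒false nl)))
      negative : ∀ v → T (not (path v) ∨ rootVar H v ∨ not (force τ v))
      negative v with T? (path v) | T? (rootVar H v)
      ... | no off | _      = ∨⁺ (inj₁ (not⁺ off))
      ... | yes on | yes r  = ∨⁺ {not (path v)} (inj₂ (∨⁺ (inj₁ r)))
      ... | yes on | no nr  = ∨⁺ {not (path v)} (inj₂ (∨⁺ {rootVar H v} (inj₂ (not⁺ (force-off v on nr)))))
      positive : ∀ v → T (not (path v ∧ internalVar H v) ∨ all (λ w → not (siblings H v w) ∨ force τ w) (vertices H))
      positive v with T? (path v ∧ internalVar H v)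
      ... | no off = ∨⁺ (inj₁ (not⁺ off))
      ... | yes t with ∧⁻ {path v} t
      ... | on , iv = ∨⁺ {not (path v ∧ internalVar H v)} (inj₂ (allFin⁺ _ sib))
        where
        sib : ∀ w → T (not (siblings H v w) ∨ force τ w)
        sib w with T? (siblings H v w)
        ... | no ¬s = ∨⁺ (inj₁ (not⁺ ¬s))
        ... | yes s with sibling-constrained v w on iv s
        ... | w∈ , ¬on , nr = ∨⁺ {not (siblings H v w)} (inj₂ (∨⁺ (inj₁
                (subst T (sym (trans (con w w∈ nr) (cong not (¬T⇒false ¬on)))) _))))

    tᵢ : Fin n
    tᵢ = root i

    tⱼ : Fin n
    tⱼ = root j

    path-ℓ : T (path ℓ)
    path-ℓ = ∨⁺ (inj₁ (anc-refl i ℓ))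

    path-tᵢ : T (path tᵢ)
    path-tᵢ = ∨⁺ (inj₁ (anc-root i ℓ ℓ∈ᵢ))

    path-tⱼ : T (path tⱼ)
    path-tⱼ = ∨⁺ {anc H i ℓ tⱼ} (inj₂ (anc-root j ℓ ℓ∈ⱼ))

    -- All clauses with leaf `ℓ` have the same path, so one positive variable on it other than `ℓ`
    -- blocks each of them.
    unforced-ℓ : ∀ τ t → T (path t) → t ≢ ℓ → T (τ t) → forced τ ℓ ≡ false
    unforced-ℓ τ t on t≢ℓ τt = any-refute (All.map (λ { {a , b , ℓ′} pe′ → refute a b ℓ′ pe′ }) all-pseudoedges)
      where
      refute : ∀ a b ℓ′ → IsPseudoedge H a b ℓ′ → ¬ T (forcedBy τ ℓ (a , b , ℓ′))
      refute a b ℓ′ pe′ f with ∧⁻ {_==_ H ℓ′ ℓ} f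
      ... | e , offs with ≟⁻ {u = ℓ′} e
      ... | refl with ∨⁻ {not (onPath H a b ℓ t)} (allFin⁻ _ offs t)
      ... | inj₁ ¬on = not⁻ ¬on (subst T (sym (onPath-unique i j a b ℓ pe pe′ t)) on)
      ... | inj₂ rest with ∨⁻ {_==_ H t ℓ} rest
      ... | inj₁ t=ℓ = t≢ℓ (≟⁻ t=ℓ)
      ... | inj₂ ¬τt = not⁻ ¬τt τt

    -- A leaf that is the root of a one-vertex tree is exempt from being negative.
    X-bound-rootLeaf : T (rootVar H ℓ) → powℚ ½ (length constrained) ≤ Pr H (X H (i , j , ℓ))
    X-bound-rootLeaf r = ≤-trans (𝔼-matches (not ∘ path) constrained)
      (≤-trans (𝔼-mono (λ τ → 𝟙-mono (λ t → respects-force τ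
                 (λ v v∈ _ → ∈-matches (not ∘ path) constrained τ t v∈) (λ nr → ⊥-elim (nr r)))))
               (≤-reflexive (sym (Pr-uniform _ (X-ext (i , j , ℓ))))))

    -- The two roots take the values x and y; they are the only path variables that may be positive.
    target : Bool → Bool → Bits n
    target x y v = if ⌊ v ≟ tᵢ ⌋ then x else (if ⌊ v ≟ tⱼ ⌋ then y else not (path v))

    target-nonroot : ∀ x y v → ¬ T (rootVar H v) → target x y v ≡ not (path v)
    target-nonroot x y v nr with v ≟ tᵢ | v ≟ tⱼ
    ... | yes refl | _        = ⊥-elim (nr (rootVar⁺ i))
    ... | no _     | yes refl = ⊥-elim (nr (rootVar⁺ j))
    ... | no _     | no _     = refl

    target-tᵢ : ∀ x y → target x y tᵢ ≡ x
    target-tᵢ x y with tᵢ ≟ tᵢ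
    ... | yes _ = refl
    ... | no ne = ⊥-elim (ne refl)

    module _ (nrℓ : ¬ T (rootVar H ℓ)) where

      tᵢ≢ℓ : tᵢ ≢ ℓ
      tᵢ≢ℓ e = nrℓ (subst (T ∘ rootVar H) e (rootVar⁺ i))

      tⱼ≢ℓ : tⱼ ≢ ℓ
      tⱼ≢ℓ e = nrℓ (subst (T ∘ rootVar H) e (rootVar⁺ j))

      -- A common root would be a second shared vertex besides `ℓ`, which is not a root here.
      tᵢ≢tⱼ : tᵢ ≢ tⱼ
      tᵢ≢tⱼ e = tᵢ≢ℓ (shareOne i j tᵢ ℓ i≢j (proj₁ (trees i))
        (subst (T ∘ mem j) (sym e) (proj₁ (trees j))) ℓ∈ᵢ ℓ∈ⱼ)

      target-tⱼ : ∀ x y → target x y tⱼ ≡ y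
      target-tⱼ x y with tⱼ ≟ tᵢ | tⱼ ≟ tⱼ
      ... | yes e | _     = ⊥-elim (tᵢ≢tⱼ (sym e))
      ... | no _  | yes _ = refl
      ... | no _  | no ne = ⊥-elim (ne refl)

      scope : List (Fin n)
      scope = tᵢ ∷ tⱼ ∷ ℓ ∷ constrained

      event : Bool → Bool → Bits n → Bool
      event x y = matches (target x y) scope

      event-tᵢ : ∀ x y τ → T (event x y τ) → τ tᵢ ≡ x
      event-tᵢ x y τ t = trans (∈-matches (target x y) scope τ t (here refl)) (target-tᵢ x y)

      event-tⱼ : ∀ x y τ → T (event x y τ) → τ tⱼ ≡ y
      event-tⱼ x y τ t = trans (∈-matches (target x y) scope τ t (there (here refl))) (target-tⱼ x y)

      event⇒X : ∀ x y τ → T (x ∨ y) → T (event x y τ) → T (X H (i , j , ℓ) (force τ))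
      event⇒X x y τ xy t = respects-force τ
        (λ v v∈ nr → trans (∈-matches (target x y) scope τ t (there (there (there v∈)))) (target-nonroot x y v nr))
        (λ nr → false⇒¬T (cong₂ _∨_
          (trans (∈-matches (target x y) scope τ t (there (there (here refl))))
            (trans (target-nonroot x y ℓ nr) (cong not (Equivalence.to T-≡ path-ℓ))))
          (free (∨⁻ {x} xy))))
        where
        free : T x ⊎ T y → forced τ ℓ ≡ false
        free (inj₁ tx) = unforced-ℓ τ tᵢ path-tᵢ tᵢ≢ℓ (subst T (sym (event-tᵢ x y τ t)) tx)
        free (inj₂ ty) = unforced-ℓ τ tⱼ path-tⱼ tⱼ≢ℓ (subst T (sym (event-tⱼ x y τ t)) ty)

      -- The three value patterns of the two roots with at least one positive are disjoint events,
      -- and each implies the event. The three additional prescribed bits are the two roots and `ℓ`,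
      -- whence the factor 3/8.
      X-bound-nonroot : 3ℚ * powℚ ½ (length scope) ≤ Pr H (X H (i , j , ℓ))
      X-bound-nonroot = begin
        3ℚ * q
          ≡⟨ solve 1 (λ q → con 3ℚ :* q := q :+ (q :+ q)) refl q ⟩
        q + (q + q)
          ≤⟨ ℚₚ.+-mono-≤ (bound true true) (ℚₚ.+-mono-≤ (bound true false) (bound false true)) ⟩
        𝔼 (A true true) + (𝔼 (A true false) + 𝔼 (A false true))
          ≡⟨ trans (𝔼-+ (A true true) (λ τ → A true false τ + A false true τ))
                   (cong (λ z → 𝔼 (A true true) + z) (𝔼-+ (A true false) (A false true))) ⟨
        𝔼 (λ τ → A true true τ + (A true false τ + A false true τ))
          ≤⟨ 𝔼-mono (λ τ → 𝟙-three (event true true τ) (event true false τ) (event false true τ)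
               (X H (i , j , ℓ) (force τ))
               (event⇒X true true τ _) (event⇒X true false τ _) (event⇒X false true τ _)
               (λ t t′ → clash (trans (sym (event-tⱼ true true τ t)) (event-tⱼ true false τ t′)))
               (λ t t′ → clash (trans (sym (event-tᵢ true true τ t)) (event-tᵢ false true τ t′)))
               (λ t t′ → clash (trans (sym (event-tᵢ true false τ t)) (event-tᵢ false true τ t′)))) ⟩
        𝔼 (λ τ → 𝟙 (X H (i , j , ℓ) (force τ)))
          ≡⟨ Pr-uniform _ (X-ext (i , j , ℓ)) ⟨
        Pr H (X H (i , j , ℓ)) ∎
        where
        open ℚₚ.≤-Reasoning
        open +-*-Solver
        q : ℚ
        q = powℚ ½ (length scope)
        A : Bool → Bool → Bits n → ℚ
        A x y τ = 𝟙 (event x y τ)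
        bound : ∀ x y → q ≤ 𝔼 (A x y)
        bound x y = 𝔼-matches (target x y) scope
        clash : true ≢ false
        clash ()

    X-bound : 3ℚ * powℚ ½ (3 ℕ.+ length constrained) ≤ Pr H (X H (i , j , ℓ))
    X-bound with T? (rootVar H ℓ)
    ... | no nr = X-bound-nonroot nr
    ... | yes r = ≤-trans
      -- Here the factor 3/8 is given away to match the other case.
      (≤-trans (≤-reflexive (solve 1 (λ q → con 3ℚ :* (con ½ :* (con ½ :* (con ½ :* q))) := con (+ 3 / 8) :* q) refl q))
               (≤-trans (ℚₚ.*-monoʳ-≤-nonNeg q {{nonNegative (powℚ-nonNeg (length constrained) 0≤½)}} 3/8≤1)
                        (≤-reflexive (*-identityˡ q))))
      (X-bound-rootLeaf r)
      where
      open +-*-Solver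
      q : ℚ
      q = powℚ ½ (length constrained)
      3/8≤1 : + 3 / 8 ≤ 1ℚ
      3/8≤1 = toWitness {a? = + 3 / 8 ℚₚ.≤? 1ℚ} _

    length-constrained : length constrained ℕ.≤ 4 ℕ.+ (((kᵢ ∸ 2) ℕ.+ (kⱼ ∸ 2)) ℕ.+ ((kᵢ ∸ 2) ℕ.+ (kⱼ ∸ 2)))
    length-constrained = begin
      length constrained
        ≡⟨ trans (length-++ (branches i ℓ (kᵢ ∸ 1)))
                 (cong₂ ℕ._+_ (length-branches i ℓ (kᵢ ∸ 1)) (length-branches j ℓ (kⱼ ∸ 1))) ⟩
      ((kᵢ ∸ 1) ℕ.+ (kᵢ ∸ 1)) ℕ.+ ((kⱼ ∸ 1) ℕ.+ (kⱼ ∸ 1))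
        ≤⟨ ℕₚ.+-mono-≤ (ℕₚ.+-mono-≤ (one kᵢ) (one kᵢ)) (ℕₚ.+-mono-≤ (one kⱼ) (one kⱼ)) ⟩
      (suc a ℕ.+ suc a) ℕ.+ (suc b ℕ.+ suc b)
        ≡⟨ solve 2 (λ a b → ((con 1 :+ a) :+ (con 1 :+ a)) :+ ((con 1 :+ b) :+ (con 1 :+ b))
             := con 4 :+ ((a :+ b) :+ (a :+ b))) refl a b ⟩
      4 ℕ.+ ((a ℕ.+ b) ℕ.+ (a ℕ.+ b)) ∎
      where
      open ℕₚ.≤-Reasoning
      open ℕ-Solver
      a b : ℕ
      a = kᵢ ∸ 2
      b = kⱼ ∸ 2
      -- Used four times, this is the source of the 4. It is an inequality because both subtractions
      -- truncate for k at most 1.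
      one : ∀ k → k ∸ 1 ℕ.≤ suc (k ∸ 2)
      one zero          = ℕ.z≤n
      one (suc zero)    = ℕ.z≤n
      one (suc (suc k)) = ℕₚ.≤-refl

    probability-bound : (+ 3 / 128) * powℚ ½ (((kᵢ ∸ 2) ℕ.+ (kⱼ ∸ 2)) ℕ.+ ((kᵢ ∸ 2) ℕ.+ (kⱼ ∸ 2)))
      ≤ Pr H (X H (i , j , ℓ))
    probability-bound = ≤-trans (≤-reflexive seven)
      (≤-trans (ℚₚ.*-monoˡ-≤-nonNeg 3ℚ (powℚ-½-antitone (ℕₚ.+-monoʳ-≤ 3 length-constrained))) X-bound)
      where
      r : ℕ
      r = ((kᵢ ∸ 2) ℕ.+ (kⱼ ∸ 2)) ℕ.+ ((kᵢ ∸ 2) ℕ.+ (kⱼ ∸ 2))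
      -- The exponent 7 is 3 for the roots and the leaf plus 4 from `length-constrained`; 3/128 is 3
      -- times the 7th power of ½.
      seven : (+ 3 / 128) * powℚ ½ r ≡ 3ℚ * powℚ ½ (7 ℕ.+ r)
      seven = trans (*-assoc 3ℚ (powℚ ½ 7) (powℚ ½ r)) (cong (3ℚ *_) (sym (powℚ-+ ½ 7 r)))

theorem8 : (H : Raw) → IsPseudoexpander H →
    ((∀ i j ℓ → IsPseudoedge H i j ℓ →
    powℚ (+ 3 / 128) 49
    ≤ powℚ (Pr H (X H (i , j , ℓ))) 49 * powℚ (+ Raw.m H / 1) 40)
    × (∀ (M : List (PE H)) → IsPseudomatching H M → MutuallyIndependent H M))
theorem8 H exp = (λ i j ℓ pe → bound i j ℓ pe (height i ℓ (proj₁ (proj₂ pe))) (height j ℓ (proj₂ (proj₂ pe)))) ,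
    Tree.independent H btg
  where
  open IsPseudoexpander exp
  open Raw H using (m)
  Height : ∀ i ℓ → Set
  Height i ℓ = ∃[ k ] (iter H i k ℓ ≡ Raw.root H i × 2 ℕ.^ (49 ℕ.* (suc k ∸ 3)) ℕ.≤ m ℕ.^ 10)
  bound : ∀ i j ℓ → IsPseudoedge H i j ℓ → Height i ℓ → Height j ℓ →
    powℚ (+ 3 / 128) 49 ≤ powℚ (Pr H (X H (i , j , ℓ))) 49 * powℚ (+ m / 1) 40
  bound i j ℓ pe (kᵢ , topᵢ , hᵢ) (kⱼ , topⱼ , hⱼ) =
    powℚ-bound 49 40 (((kᵢ ∸ 2) ℕ.+ (kⱼ ∸ 2)) ℕ.+ ((kᵢ ∸ 2) ℕ.+ (kⱼ ∸ 2))) m (+ 3 / 128) (Pr H (X H (i , j , ℓ)))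
      (ℚₚ.nonNegative⁻¹ (+ 3 / 128))
      (Bound.probability-bound H btg i j ℓ pe kᵢ kⱼ topᵢ topⱼ)
      -- A path of k steps has k + 1 vertices, and `suc k ∸ 3` in the height condition reduces to
      -- `k ∸ 2`.
      (height-budget (kᵢ ∸ 2) (kⱼ ∸ 2) m hᵢ hⱼ)
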